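{- Let $G$ be a graph with $|V(G)|\ge 4$ containing two edge-disjoint spanning triangle-trees. Then $G\in\mathcal{S}_3$.
   Context: Graphs are finite, may contain parallel edges, but have no loops. Triangle-tree: a graph formed by starting with a triangle $x_1x_2x_3$ and then repeatedly (zero or more times) adding a new vertex $x_{j+1}$ joined to exactly two vertices $y,z$ that are adjacent in the graph already constructed (so $x_{j+1},y,z$ form a triangle). A spanning triangle-tree of $G$ is a subgraph of $G$ that is a triangle-tree and contains all vertices of $G$. A $\mathbb{Z}_3$-boundary of $G$ is a map $\beta:V(G)\to\mathbb{Z}_3$ with $\sum_{v\in V(G)}\beta(v)\equiv 0\pmod 3$. $\mathcal{S}_3$ is the family of all graphs $G$ such that for every $\mathbb{Z}_3$-boundary $\beta$ of $G$ there is a strongly connected orientation $D$ of $G$ with $d_D^+(u)-d_D^-(u)\equiv\beta(u)\pmod 3$ for every $u\in V(G)$ (out-degree minus in-degree). -}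

module Defs where

open import Algebra.Properties.CommutativeMonoid.Sum
open import Data.Fin using (Fin; toℕ; _≟_)
open import Data.Fin.Subset using (Subset; ⁅_⁆; _∪_; _∩_; _∈_; _∉_; ∣_∣; ⊤; Empty)
open import Data.Integer using (ℤ; +_; _-_)
open import Data.Integer.Divisibility using () renaming (_∣_ to _∣ℤ_)
open import Data.Nat using (ℕ)
open import Data.Nat.Divisibility using (_∣_)
open import Data.Nat.Properties using (+-0-commutativeMonoid)
open import Data.Product using (Σ-syntax; ∃-syntax; _×_; _,_; proj₁; proj₂)
open import Data.Sum using (_⊎_)
open import Data.Vec using (tabulate)
open import Relation.Binary.Construct.Closure.ReflexiveTransitive using (Star)
open import Relation.Binary.PropositionalEquality using (_≡_; _≢_)
open import Relation.Nullary using (does)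

-- Finite loopless multigraphs.  The two ends of an edge are stored in some
-- order, which carries no meaning: see Joins.
record Graph : Set where
  field
    order    : ℕ
    size     : ℕ
    ends     : Fin size → Fin order × Fin order
    loopless : ∀ e → proj₁ (ends e) ≢ proj₂ (ends e)

  Vertex : Set
  Vertex = Fin order

  Edge : Set
  Edge = Fin size

  Joins : Edge → Vertex → Vertex → Set
  Joins e u v = ends e ≡ (u , v) ⊎ ends e ≡ (v , u)

-- TriangleTree G S T: the subgraph of G with vertex set S and edge set T is a
-- triangle-tree.  The three vertices of the initial triangle are distinct
-- because G has no loops.
module _ (G : Graph) where
  open Graph G

  data TriangleTree : Subset order → Subset size → Set where

    triangle : ∀ {x y z e f g} →
      Joins e x y → Joins f y z → Joins g z x →
      TriangleTree (⁅ x ⁆ ∪ ⁅ y ⁆ ∪ ⁅ z ⁆) (⁅ e ⁆ ∪ ⁅ f ⁆ ∪ ⁅ g ⁆)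

    attach : ∀ {S T x y z e f g} →
      TriangleTree S T →
      x ∉ S → e ∈ T → Joins e y z →
      Joins f x y → Joins g x z →
      TriangleTree (⁅ x ⁆ ∪ S) (⁅ f ⁆ ∪ ⁅ g ⁆ ∪ T)

  SpanningTriangleTree : Subset size → Set
  SpanningTriangleTree T = TriangleTree ⊤ T

EdgeDisjoint : ∀ {m} → Subset m → Subset m → Set
EdgeDisjoint T₁ T₂ = Empty (T₁ ∩ T₂)

record Orientation (G : Graph) : Set where
  open Graph G
  field
    tail   : Edge → Vertex
    head   : Edge → Vertex
    orient : ∀ e → Joins e (tail e) (head e)

  Arc : Vertex → Vertex → Set
  Arc u v = ∃[ e ] (tail e ≡ u × head e ≡ v)

  StronglyConnected : Set
  StronglyConnected = ∀ u v → Star Arc u v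

  outdeg : Vertex → ℕ
  outdeg u = ∣ tabulate (λ e → does (tail e ≟ u)) ∣

  indeg : Vertex → ℕ
  indeg u = ∣ tabulate (λ e → does (head e ≟ u)) ∣

infix 4 _≡_[mod3]

_≡_[mod3] : ℤ → ℤ → Set
i ≡ j [mod3] = + 3 ∣ℤ i - j

-- ℤ₃ is represented by Fin 3, via the residues 0, 1, 2.
IsBoundary : (G : Graph) → (Graph.Vertex G → Fin 3) → Set
IsBoundary G β = 3 ∣ sum +-0-commutativeMonoid (λ v → toℕ (β v))

Realizes : {G : Graph} → Orientation G → (Graph.Vertex G → Fin 3) → Set
Realizes D β =
  ∀ u → + outdeg u - + indeg u ≡ + toℕ (β u) [mod3]
  where open Orientation D

InS₃ : Graph → Set
InS₃ G = ∀ β → IsBoundary G β →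
  Σ[ D ∈ Orientation G ] (Orientation.StronglyConnected D × Realizes D β)

{-# OPTIONS --safe #-}

-- An orientation is a nowhere-zero ℤ₃-flow φ, and its boundary is ∂ φ.  Peeling off
-- the vertices of a triangle-tree one by one shows that every balanced m is the
-- boundary of an orientation of the tree unless m is a sum of terms ± 1_Δ, one for
-- each triangle Δ.  As the vectors 1_Δ are linearly independent, this exception
-- consists of linear conditions: m has residue 0 and all its coefficients are nonzero.
--
-- Let k be the number of triangles of each tree.  Orient T₂ strongly, sending each
-- triangle after the first along its attaching edge yᵢzᵢ in either direction; this
-- gives the boundaries Σ ± wᵢ with k - 1 dipoles wᵢ = 1_yᵢ - 1_zᵢ and free signs.  It
-- remains to choose the signs such that T₁ realises β - Σ ± wᵢ.  If wᵢ has nonzero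
-- residue, some sign of wᵢ works.  If all wᵢ have residue 0, each has at least two
-- nonzero coefficients; for 2 (k - 1) > k two dipoles share a triangle, and their
-- signs can be chosen to make the coefficient there zero.  This leaves k = 2, where
-- only β = 0 on two crossed diamonds needs an explicit orientation.
module Submission where

open import Defs
open import Data.Fin.Subset using (Subset)
open import Data.Nat using (_≥_)

open import Algebra.Bundles using (Semiring)
import Algebra.Properties.CommutativeMonoid.Sum as Sum
open import Data.Bool using (Bool; true; false; if_then_else_)
open import Data.Empty using (⊥)
open import Data.Fin using (Fin; zero; suc; toℕ; _≟_; combine; remQuot)
open import Data.Fin.Patterns using (0F; 1F; 2F)
open import Data.Fin.Properties using (all?; any?; pigeonhole; combine-remQuot; <⇒≢; suc-injective)
open import Data.Fin.Subset using (⁅_⁆; _∪_; _∈_; _∉_; ∣_∣; ⊤; ∁; inside; outside)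
open import Data.Fin.Subset.Properties
  using (x∈⁅x⁆; x∈⁅y⁆⇒x≡y; x∈p∪q⁻; x∈p∪q⁺; x∈p∩q⁺; x∈∁p⇒x∉p; x∉p⇒x∈∁p; x∈p⇒x∉∁p; p∪∁p≡⊤;
         ∪-assoc; ∪-comm; ∪-identityˡ; ∣⊤∣≡n; ∣⁅x⁆∣≡1; ∈⊤; _∈?_)
open import Data.Integer as ℤ using () renaming (+_ to pos)
open import Data.Integer.Divisibility.Signed using (divides; ∣⇒∣ᵤ)
import Data.Integer.Properties as ℤₚ
open import Data.Integer.Solver using (module +-*-Solver)
open import Data.Nat as ℕ using (ℕ; zero; suc)
open import Data.Nat.Divisibility using () renaming (divides to dividesℕ)
import Data.Nat.Properties as ℕₚ
open import Data.Product using (Σ-syntax; ∃-syntax; ∃₂; _×_; _,_; proj₁; proj₂; uncurry)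
open import Data.Sum using (_⊎_; inj₁; inj₂; swap; [_,_]′)
open import Data.Vec using (tabulate; _∷_; here; there)
import Data.Vec.Functional as Vector
open import Function using (_∘_; flip)
open import Relation.Binary.Construct.Closure.ReflexiveTransitive using (Star; ε; _◅_; _◅◅_)
  renaming (map to Star-map)
open import Relation.Binary.PropositionalEquality
open import Relation.Nullary using (¬_; does; yes; no; contradiction; ¬?; _×-dec_; _→-dec_; decidable-stable)
open import Relation.Nullary.Decidable using (toWitness; dec-true; dec-false)

open ≡-Reasoning

-- Arithmetic in ℤ₃

infixl 6 _+_ _-_
infixl 7 _*_
infix  8 -_

_+_ : Fin 3 → Fin 3 → Fin 3
0F + b  = b
1F + 0F = 1F
1F + 1F = 2F
1F + 2F = 0F
2F + 0F = 2F
2F + 1F = 0F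
2F + 2F = 1F

_*_ : Fin 3 → Fin 3 → Fin 3
0F * _ = 0F
1F * b = b
2F * b = b + b

-_ : Fin 3 → Fin 3
- a = 2F * a

_-_ : Fin 3 → Fin 3 → Fin 3
a - b = a + - b

-- Here and below, statements about finitely many elements of ℤ₃ are decided by evaluating all
-- cases; the holes in `_ ≟ _` are solved from the stated type.
+-assoc : ∀ a b c → a + b + c ≡ a + (b + c)
+-assoc = toWitness {a? = all? λ a → all? λ b → all? λ c → _ ≟ _} _

+-comm : ∀ a b → a + b ≡ b + a
+-comm = toWitness {a? = all? λ a → all? λ b → _ ≟ _} _

+-identityʳ : ∀ a → a + 0F ≡ a
+-identityʳ = toWitness {a? = all? λ a → _ ≟ _} _

*-assoc : ∀ a b c → a * b * c ≡ a * (b * c)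
*-assoc = toWitness {a? = all? λ a → all? λ b → all? λ c → _ ≟ _} _

*-identityʳ : ∀ a → a * 1F ≡ a
*-identityʳ = toWitness {a? = all? λ a → _ ≟ _} _

*-zeroʳ : ∀ a → a * 0F ≡ 0F
*-zeroʳ = toWitness {a? = all? λ a → _ ≟ _} _

*-distribˡ-+ : ∀ a b c → a * (b + c) ≡ a * b + a * c
*-distribˡ-+ = toWitness {a? = all? λ a → all? λ b → all? λ c → _ ≟ _} _

*-distribʳ-+ : ∀ a b c → (b + c) * a ≡ b * a + c * a
*-distribʳ-+ = toWitness {a? = all? λ a → all? λ b → all? λ c → _ ≟ _} _

-‿≢0 : ∀ a → a ≢ 0F → - a ≢ 0F
-‿≢0 = toWitness {a? = all? λ a → ¬? (_ ≟ _) →-dec ¬? (_ ≟ _)} _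

ℤ₃-semiring : Semiring _ _
ℤ₃-semiring = record
  { Carrier = Fin 3 ; _≈_ = _≡_ ; _+_ = _+_ ; _*_ = _*_ ; 0# = 0F ; 1# = 1F
  ; isSemiring = record
    { isSemiringWithoutAnnihilatingZero = record
      { +-isCommutativeMonoid = record
        { isMonoid = record
          { isSemigroup = record
            { isMagma = record { isEquivalence = isEquivalence ; ∙-cong = cong₂ _+_ }
            ; assoc = +-assoc }
          ; identity = (λ _ → refl) , +-identityʳ }
        ; comm = +-comm }
      ; *-cong = cong₂ _*_
      ; *-assoc = *-assoc
      ; *-identity = (λ _ → refl) , *-identityʳ
      ; distrib = *-distribˡ-+ , *-distribʳ-+ }
    ; zero = (λ _ → refl) , *-zeroʳ } }

open Sum (Semiring.+-commutativeMonoid ℤ₃-semiring)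
  using (sum; sum-cong-≗; ∑-distrib-+; ∑-comm; sum-replicate-zero)

-- Indicators and finite sums

δ : ∀ {n} → Fin n → Fin n → Fin 3
δ u v = if does (u ≟ v) then 1F else 0F

δ-refl : ∀ {n} (u : Fin n) → δ u u ≡ 1F
δ-refl u rewrite dec-true (u ≟ u) refl = refl

δ-≢ : ∀ {n} {u v : Fin n} → u ≢ v → δ u v ≡ 0F
δ-≢ {u = u} {v} u≢v rewrite dec-false (u ≟ v) u≢v = refl

sum-zero : ∀ {n} {f : Fin n → Fin 3} → (∀ i → f i ≡ 0F) → sum f ≡ 0F
sum-zero {n} f≡0 = trans (sum-cong-≗ f≡0) (sum-replicate-zero n)

sum-single : ∀ {n} (f : Fin n → Fin 3) i → (∀ j → j ≢ i → f j ≡ 0F) → sum f ≡ f i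
sum-single f zero h =
  trans (cong (f zero +_) (sum-zero (λ j → h (suc j) (λ ())))) (+-identityʳ _)
sum-single f (suc i) h =
  cong₂ _+_ (h zero (λ ())) (sum-single (f ∘ suc) i (λ j j≢i → h (suc j) (j≢i ∘ suc-injective)))

sum-δ : ∀ {n} u (f : Fin n → Fin 3) → sum (λ v → δ u v * f v) ≡ f u
sum-δ u f = begin
  sum (λ v → δ u v * f v) ≡⟨ sum-single _ u (λ j j≢u → cong (_* f j) (δ-≢ (j≢u ∘ sym))) ⟩
  δ u u * f u             ≡⟨ cong (_* f u) (δ-refl u) ⟩
  f u                     ∎

sum-dipole : ∀ {n} t (u w : Fin n) → sum (λ v → t * (δ u v - δ w v)) ≡ 0F
sum-dipole t u w = begin
  sum (λ v → t * (δ u v - δ w v))                     ≡⟨ sum-cong-≗ (λ v → rearrange t (δ u v) (δ w v)) ⟩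
  sum (λ v → δ u v * t + δ w v * - t)                 ≡⟨ ∑-distrib-+ (λ v → δ u v * t) (λ v → δ w v * - t) ⟩
  sum (λ v → δ u v * t) + sum (λ v → δ w v * - t)     ≡⟨ cong₂ _+_ (sum-δ u (λ _ → t)) (sum-δ w (λ _ → - t)) ⟩
  t + - t                                             ≡⟨ cancel t ⟩
  0F                                                  ∎
  where
  rearrange : ∀ t a b → t * (a - b) ≡ a * t + b * - t
  rearrange = toWitness {a? = all? λ _ → all? λ _ → all? λ _ → _ ≟ _} _
  cancel : ∀ t → t + - t ≡ 0F
  cancel = toWitness {a? = all? λ _ → _ ≟ _} _

vanishing : ∀ {n} {f : Fin n → Fin 3} → ¬ (∃[ i ] f i ≢ 0F) → ∀ i → f i ≡ 0F
vanishing {f = f} none i = decidable-stable (f i ≟ 0F) λ ≢0 → none (i , ≢0)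

-- Signed sums of vectors over ℤ₃

infixl 6 _⊞_

_⊞_ : ∀ {n} → (Fin n → Fin 3) → (Fin n → Fin 3) → Fin n → Fin 3
(f ⊞ g) i = f i + g i

shift : ∀ {n r} → (Fin n → Fin 3) → (Fin r → Fin 3) → (Fin r → Fin n → Fin 3) → Fin n → Fin 3
shift m σ w v = m v + sum (λ i → σ i * w i v)

-- Signed sums are accumulated one term `c * w` at a time, so linearity is recorded for exactly that
-- step. Vectors are compared pointwise, which makes `≗-cong` a field.
record Linear {n} (φ : (Fin n → Fin 3) → Fin 3) : Set where
  field
    ≗-cong : ∀ {m m′} → m ≗ m′ → φ m ≡ φ m′
    axpy   : ∀ m c w → φ (λ v → m v + c * w v) ≡ φ m + c * φ w

  map-shift : ∀ {r} m (σ : Fin r → Fin 3) w →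
    φ (shift m σ w) ≡ φ m + sum (λ i → σ i * φ (w i))
  map-shift {zero}  m σ w = trans (≗-cong (λ v → +-identityʳ (m v))) (sym (+-identityʳ _))
  map-shift {suc r} m σ w = begin
    φ (shift m σ w)
      ≡⟨ ≗-cong (λ v → sym (+-assoc (m v) _ _)) ⟩
    -- The first term is absorbed into the starting vector, so that the induction hypothesis applies
    -- to the remaining ones.
    φ (shift (λ v → m v + σ zero * w zero v) (σ ∘ suc) (w ∘ suc))
      ≡⟨ map-shift _ (σ ∘ suc) (w ∘ suc) ⟩
    φ (λ v → m v + σ zero * w zero v) + sum (λ i → σ (suc i) * φ (w (suc i)))
      ≡⟨ cong (_+ _) (axpy m (σ zero) (w zero)) ⟩
    φ m + σ zero * φ (w zero) + sum (λ i → σ (suc i) * φ (w (suc i)))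
      ≡⟨ +-assoc (φ m) _ _ ⟩
    φ m + sum (λ i → σ i * φ (w i)) ∎

Signs : ℕ → Set
Signs r = Σ[ σ ∈ (Fin r → Fin 3) ] ∀ i → σ i ≢ 0F

_∷ₛ_ : ∀ {r} → Σ[ e ∈ Fin 3 ] e ≢ 0F → Signs r → Signs (suc r)
((e , e≢0) ∷ₛ (σ , σ≢0)) = (e Vector.∷ σ) , λ { zero → e≢0 ; (suc i) → σ≢0 i }

positive : ∀ {r} → Signs r
positive = (λ _ → 1F) , λ _ ()

dot : ∀ {r} → Signs r → (Fin r → Fin 3) → Fin 3
dot (σ , _) a = sum (λ i → σ i * a i)

-- All signs but the one at `i` are positive. The two choices for that sign give different sums
-- because `a i` is nonzero, and at most one of these sums is `d`.
signs-avoid : ∀ {r} (a : Fin r → Fin 3) i → a i ≢ 0F → ∀ d → Σ[ σ ∈ Signs r ] dot σ a ≢ d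
signs-avoid a zero a₀≢0 d =
  let e , e≢0 , e*a₀≢d = choose (a zero) (dot positive (a ∘ suc)) d a₀≢0
  in (e , e≢0) ∷ₛ positive , e*a₀≢d
  where
  choose : ∀ a t d → a ≢ 0F → ∃[ e ] e ≢ 0F × e * a + t ≢ d
  choose = toWitness {a? = all? λ _ → all? λ _ → all? λ _ → ¬? (_ ≟ _) →-dec
    any? λ _ → ¬? (_ ≟ _) ×-dec ¬? (_ ≟ _)} _
signs-avoid a (suc i) aᵢ≢0 d =
  let σ , σ·a≢ = signs-avoid (a ∘ suc) i aᵢ≢0 (d - a zero)
  in (1F , λ ()) ∷ₛ σ , λ eq → σ·a≢ (move (a zero) _ d eq)
  where
  move : ∀ a t d → a + t ≡ d → t ≡ d - a
  move = toWitness {a? = all? λ _ → all? λ _ → all? λ _ → _ ≟ _ →-dec _ ≟ _} _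

-- Once the other signs are chosen with a sum t ≠ d, the sign at i can be solved for,
-- since d - t is then ± a i.
signs-hit : ∀ {r} (a : Fin r → Fin 3) i j → i ≢ j → a i ≢ 0F → a j ≢ 0F →
  ∀ d → Σ[ σ ∈ Signs r ] dot σ a ≡ d
signs-hit a zero zero i≢j _ _ d = contradiction refl i≢j
signs-hit {suc r} a zero (suc j) _ a₀≢0 aⱼ≢0 d =
  let σ , σ·a≢d = signs-avoid (a ∘ suc) j aⱼ≢0 d
      e , e≢0 , eq = solve (a zero) (dot σ (a ∘ suc)) d a₀≢0 σ·a≢d
  in (e , e≢0) ∷ₛ σ , eq
  where
  solve : ∀ a t d → a ≢ 0F → t ≢ d → ∃[ e ] e ≢ 0F × e * a + t ≡ d
  solve = toWitness {a? = all? λ _ → all? λ _ → all? λ _ → ¬? (_ ≟ _) →-dec ¬? (_ ≟ _) →-dec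
    any? λ _ → ¬? (_ ≟ _) ×-dec _ ≟ _} _
signs-hit a (suc i) zero i≢j aᵢ≢0 a₀≢0 d = signs-hit a zero (suc i) (i≢j ∘ sym) a₀≢0 aᵢ≢0 d
signs-hit a (suc i) (suc j) i≢j aᵢ≢0 aⱼ≢0 d =
  let σ , σ·a≡ = signs-hit (a ∘ suc) i j (i≢j ∘ cong suc) aᵢ≢0 aⱼ≢0 (d - a zero)
  in (1F , λ ()) ∷ₛ σ , move (a zero) _ d σ·a≡
  where
  move : ∀ a t d → t ≡ d - a → a + t ≡ d
  move = toWitness {a? = all? λ _ → all? λ _ → all? λ _ → _ ≟ _ →-dec _ ≟ _} _

-- The two values ± `a zero` are precisely the nonzero elements of ℤ₃.
signs-hit₁ : ∀ (a : Fin 1 → Fin 3) → a zero ≢ 0F → ∀ d → d ≢ 0F → Σ[ σ ∈ Signs 1 ] dot σ a ≡ d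
signs-hit₁ a a₀≢0 d d≢0 =
  let e , e≢0 , eq = solve (a zero) d a₀≢0 d≢0 in (e , e≢0) ∷ₛ positive , eq
  where
  solve : ∀ a d → a ≢ 0F → d ≢ 0F → ∃[ e ] e ≢ 0F × e * a + 0F ≡ d
  solve = toWitness {a? = all? λ _ → all? λ _ → ¬? (_ ≟ _) →-dec ¬? (_ ≟ _) →-dec
    any? λ _ → ¬? (_ ≟ _) ×-dec _ ≟ _} _

-- A 0/1 vector takes equal values on its support, so a multiple of one such
-- vector cannot take both of the values 1 and 2.
two-coefficients : ∀ {n k} (c : Fin k → Fin 3) (D : Fin k → Fin n → Fin 3) →
  (∀ j v → D j v ≢ 2F) → ∀ {y z} →
  sum (λ j → c j * D j y) ≡ 1F → sum (λ j → c j * D j z) ≡ 2F →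
  ∃₂ λ i j → i ≢ j × c i ≢ 0F × c j ≢ 0F
two-coefficients c D D≢2 {y} {z} at-y at-z with any? (λ j → ¬? (c j ≟ 0F))
... | no none = contradiction (trans (sym at-y) (sum-zero vanish)) λ ()
  where
  vanish : ∀ j → c j * D j y ≡ 0F
  vanish j = cong (_* D j y) (decidable-stable (c j ≟ 0F) (λ c≢0 → none (j , c≢0)))
... | yes (i , cᵢ≢0) with any? (λ j → ¬? (i ≟ j) ×-dec ¬? (c j ≟ 0F))
...   | yes (j , i≢j , cⱼ≢0) = i , j , i≢j , cᵢ≢0 , cⱼ≢0
...   | no none = contradiction
  (trans (sym (only z)) at-z) (conflict (c i) (D i y) (D i z) (D≢2 i y) (D≢2 i z) (trans (sym (only y)) at-y))
  where
  only : ∀ v → sum (λ j → c j * D j v) ≡ c i * D i v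
  only v = sum-single _ i λ j j≢i → cong (_* D j v)
    (decidable-stable (c j ≟ 0F) (λ c≢0 → none (j , j≢i ∘ sym , c≢0)))
  conflict : ∀ c d d′ → d ≢ 2F → d′ ≢ 2F → c * d ≡ 1F → c * d′ ≢ 2F
  conflict = toWitness {a? = all? λ _ → all? λ _ → all? λ _ → ¬? (_ ≟ _) →-dec ¬? (_ ≟ _) →-dec
    _ ≟ _ →-dec ¬? (_ ≟ _)} _

-- Pigeonhole on the r * 2 pairs (i , a), coded by `remQuot`. Two pairs with the same `i` cannot
-- collide, since the two values of `p i` differ.
shared-value : ∀ {r k} → k ℕ.< r ℕ.* 2 → (p : Fin r → Fin 2 → Fin k) → (∀ i → p i 0F ≢ p i 1F) →
  ∃₂ λ i j → ∃₂ λ a b → i ≢ j × p i a ≡ p j b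
shared-value {r} k<2r p p₀≢p₁ =
  let x , y , x<y , eq = pigeonhole k<2r (uncurry p ∘ remQuot {r} 2)
  in separate (remQuot 2 x) (remQuot 2 y) (<⇒≢ x<y ∘ remQuot-injective x y) eq
  where
  remQuot-injective : ∀ x y → remQuot {r} 2 x ≡ remQuot 2 y → x ≡ y
  remQuot-injective x y eq = trans (sym (combine-remQuot {r} 2 x))
    (trans (cong (uncurry (combine {r} {2})) eq) (combine-remQuot {r} 2 y))
  separate : ∀ x y → x ≢ y → uncurry p x ≡ uncurry p y →
    ∃₂ λ i j → ∃₂ λ a b → i ≢ j × p i a ≡ p j b
  separate (i , a) (j , b) x≢y eq with i ≟ j
  separate (i , a)  (j , b)  x≢y eq | no i≢j = i , j , a , b , i≢j , eq
  separate (i , 0F) (_ , 0F) x≢y eq | yes refl = contradiction refl x≢y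
  separate (i , 0F) (_ , 1F) x≢y eq | yes refl = contradiction eq (p₀≢p₁ i)
  separate (i , 1F) (_ , 0F) x≢y eq | yes refl = contradiction (sym eq) (p₀≢p₁ i)
  separate (i , 1F) (_ , 1F) x≢y eq | yes refl = contradiction refl x≢y

-- Finite subsets

∈-new : ∀ {n} {x : Fin n} {S} → x ∈ ⁅ x ⁆ ∪ S
∈-new {x = x} = x∈p∪q⁺ (inj₁ (x∈⁅x⁆ x))

∈-old : ∀ {n} {x y : Fin n} {S} → x ∈ S → x ∈ ⁅ y ⁆ ∪ S
∈-old x∈S = x∈p∪q⁺ (inj₂ x∈S)

∈-cons⁻ : ∀ {n} {x y : Fin n} {S} → x ∈ ⁅ y ⁆ ∪ S → x ≡ y ⊎ x ∈ S
∈-cons⁻ {y = y} {S} x∈ with x∈p∪q⁻ ⁅ y ⁆ S x∈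
... | inj₁ x∈y = inj₁ (x∈⁅y⁆⇒x≡y y x∈y)
... | inj₂ x∈S = inj₂ x∈S

∪-swap : ∀ {n} (A B C : Subset n) → A ∪ B ∪ C ≡ B ∪ A ∪ C
∪-swap A B C = trans (sym (∪-assoc A B C)) (trans (cong (_∪ C) (∪-comm A B)) (∪-assoc B A C))

∪-swapʳ : ∀ {n} (A B C : Subset n) → A ∪ B ∪ C ≡ A ∪ C ∪ B
∪-swapʳ A B C = cong (A ∪_) (∪-comm B C)

∪-rotate : ∀ {n} (A B C : Subset n) → A ∪ B ∪ C ≡ C ∪ A ∪ B
∪-rotate A B C = trans (∪-swapʳ A B C) (∪-swap A C B)

∪-rotate⁻ : ∀ {n} (A B C : Subset n) → A ∪ B ∪ C ≡ B ∪ C ∪ A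
∪-rotate⁻ A B C = sym (∪-rotate B C A)

∪-reverse : ∀ {n} (A B C : Subset n) → A ∪ B ∪ C ≡ C ∪ B ∪ A
∪-reverse A B C = trans (∪-rotate A B C) (∪-swapʳ C A B)

∣cons∣ : ∀ {n} {x : Fin n} {S : Subset n} → x ∉ S → ∣ ⁅ x ⁆ ∪ S ∣ ≡ suc ∣ S ∣
∣cons∣ {x = zero}  {inside  ∷ S} x∉S = contradiction here x∉S
∣cons∣ {x = zero}  {outside ∷ S} _   = cong (suc ∘ ∣_∣) (∪-identityˡ S)
∣cons∣ {x = suc x} {inside  ∷ S} x∉S = cong suc (∣cons∣ (x∉S ∘ there))
∣cons∣ {x = suc x} {outside ∷ S} x∉S = ∣cons∣ (x∉S ∘ there)

-- Residues modulo 3 of natural numbers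

mod₃ : ℕ → Fin 3
mod₃ zero    = 0F
mod₃ (suc n) = 1F + mod₃ n

mod₃-+ : ∀ m n → mod₃ (m ℕ.+ n) ≡ mod₃ m + mod₃ n
mod₃-+ zero    n = refl
mod₃-+ (suc m) n = trans (cong (1F +_) (mod₃-+ m n)) (sym (+-assoc 1F (mod₃ m) (mod₃ n)))

mod₃-*3 : ∀ q → mod₃ (q ℕ.* 3) ≡ 0F
mod₃-*3 zero    = refl
mod₃-*3 (suc q) = trans (mod₃-+ 3 (q ℕ.* 3)) (mod₃-*3 q)

mod₃-toℕ : ∀ a → mod₃ (toℕ a) ≡ a
mod₃-toℕ = toWitness {a? = all? λ _ → _ ≟ _} _

mod₃-sum : ∀ {n} (f : Fin n → ℕ) →
  mod₃ (Sum.sum ℕₚ.+-0-commutativeMonoid f) ≡ sum (mod₃ ∘ f)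
mod₃-sum {zero}  f = refl
mod₃-sum {suc n} f = trans (mod₃-+ (f zero) _) (cong (mod₃ (f zero) +_) (mod₃-sum (f ∘ suc)))

mod₃-count : ∀ {n} (p : Fin n → Bool) →
  mod₃ ∣ tabulate p ∣ ≡ sum (λ i → if p i then 1F else 0F)
mod₃-count {zero}  p = refl
mod₃-count {suc n} p with p zero
... | true  = cong (1F +_) (mod₃-count (p ∘ suc))
... | false = mod₃-count (p ∘ suc)

division : ∀ n → ∃[ q ] n ≡ toℕ (mod₃ n) ℕ.+ q ℕ.* 3
division zero = 0 , refl
division (suc n) with mod₃ n | division n
... | 0F | q , eq = q , cong suc eq
... | 1F | q , eq = q , cong suc eq
... | 2F | q , eq = suc q , cong suc eq

-- Both `a` and `b + toℕ c` have remainder `mod₃ b + c`, so they differ by 3 times the difference of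
-- their quotients.
congruent : ∀ a b c → mod₃ a ≡ mod₃ b + c → pos a ℤ.- pos b ≡ pos (toℕ c) [mod3]
congruent a b c eq
  with qa , a≡ ← division a | qb , bc≡ ← division (b ℕ.+ toℕ c)
  = ∣⇒∣ᵤ (divides (pos qa ℤ.- pos qb) (begin
    pos a ℤ.- pos b ℤ.- pos (toℕ c)              ≡⟨ regroup (pos a) (pos b) (pos (toℕ c)) ⟩
    pos a ℤ.- (pos b ℤ.+ pos (toℕ c))            ≡⟨ cong₂ (λ x y → pos x ℤ.- y) a≡
                                                    (trans (sym (ℤₚ.pos-+ b (toℕ c))) (cong pos bc≡)) ⟩
    pos (toℕ (mod₃ a) ℕ.+ qa ℕ.* 3) ℤ.- pos (toℕ (mod₃ (b ℕ.+ toℕ c)) ℕ.+ qb ℕ.* 3)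
      ≡⟨ cong₂ (λ r r′ → pos (toℕ r ℕ.+ qa ℕ.* 3) ℤ.- pos (toℕ r′ ℕ.+ qb ℕ.* 3)) eq same ⟩
    pos (toℕ (mod₃ b + c) ℕ.+ qa ℕ.* 3) ℤ.- pos (toℕ (mod₃ b + c) ℕ.+ qb ℕ.* 3)
      ≡⟨ cong₂ ℤ._-_ (expand qa) (expand qb) ⟩
    (pos r ℤ.+ pos qa ℤ.* pos 3) ℤ.- (pos r ℤ.+ pos qb ℤ.* pos 3) ≡⟨ cancel (pos r) (pos qa) (pos qb) ⟩
    (pos qa ℤ.- pos qb) ℤ.* pos 3              ∎))
  where
  open +-*-Solver
  r = toℕ (mod₃ b + c)
  same : mod₃ (b ℕ.+ toℕ c) ≡ mod₃ b + c
  same = trans (mod₃-+ b (toℕ c)) (cong (mod₃ b +_) (mod₃-toℕ c))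
  expand : ∀ q → pos (r ℕ.+ q ℕ.* 3) ≡ pos r ℤ.+ pos q ℤ.* pos 3
  expand q = trans (ℤₚ.pos-+ r (q ℕ.* 3)) (cong (λ x → pos r ℤ.+ x) (ℤₚ.pos-* q 3))
  regroup : ∀ a b c → a ℤ.- b ℤ.- c ≡ a ℤ.- (b ℤ.+ c)
  regroup = solve 3 (λ a b c → a :- b :- c := a :- (b :+ c)) refl
  cancel : ∀ r p q → (r ℤ.+ p ℤ.* pos 3) ℤ.- (r ℤ.+ q ℤ.* pos 3) ≡ (p ℤ.- q) ℤ.* pos 3
  cancel = solve 3 (λ r p q → (r :+ p :* con (pos 3)) :- (r :+ q :* con (pos 3)) := (p :- q) :* con (pos 3)) refl

-- Flows and their boundaries

module TriangleTrees (G : Graph) where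
  open Graph G

  -- A nowhere-zero ℤ₃-valued function on the edges is an orientation: the value
  -- 1 keeps the stored order of the ends and the value 2 reverses it.
  Flow : Set
  Flow = Edge → Fin 3

  Charge : Set
  Charge = Vertex → Fin 3

  incidence : Edge → Charge
  incidence e v = δ (proj₁ (ends e)) v - δ (proj₂ (ends e)) v

  ∂ : Flow → Charge
  ∂ f v = sum (λ e → f e * incidence e v)

  ∂-⊞ : ∀ f g v → ∂ (f ⊞ g) v ≡ ∂ f v + ∂ g v
  ∂-⊞ f g v = trans (sum-cong-≗ λ e → *-distribʳ-+ _ (f e) (g e))
    (∑-distrib-+ (λ e → f e * incidence e v) (λ e → g e * incidence e v))

  single : Edge → Fin 3 → Flow
  single e t e′ = δ e e′ * t

  -- Sends `t` from `u` to `v` whatever the stored order of the ends: the sign absorbs a reversed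
  -- order, so `∂-arc` has a single form.
  arc : ∀ {e u v} → Joins e u v → Fin 3 → Flow
  arc {e} (inj₁ _) t = single e t
  arc {e} (inj₂ _) t = single e (- t)

  ∂-single : ∀ e t v → ∂ (single e t) v ≡ t * incidence e v
  ∂-single e t v = trans (sum-cong-≗ λ e′ → *-assoc (δ e e′) t _) (sum-δ e _)

  ∂-arc : ∀ {e u w} (j : Joins e u w) t v → ∂ (arc j t) v ≡ t * (δ u v - δ w v)
  ∂-arc {e} (inj₁ refl) t v = ∂-single e t v
  ∂-arc {e} {u} {w} (inj₂ refl) t v = trans (∂-single e (- t) v) (negate t (δ w v) (δ u v))
    where
    negate : ∀ t a b → - t * (a - b) ≡ t * (b - a)
    negate = toWitness {a? = all? λ _ → all? λ _ → all? λ _ → _ ≟ _} _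

  sum-∂ : ∀ f → sum (∂ f) ≡ 0F
  sum-∂ f = trans (∑-comm λ v e → f e * incidence e v)
                  (sum-zero λ e → sum-dipole (f e) (proj₁ (ends e)) (proj₂ (ends e)))

  arc-off : ∀ {e e′ u v} (j : Joins e u v) t → e ≢ e′ → arc j t e′ ≡ 0F
  arc-off (inj₁ _) t e≢e′ = cong (_* t) (δ-≢ e≢e′)
  arc-off (inj₂ _) t e≢e′ = cong (_* - t) (δ-≢ e≢e′)

  arc-on : ∀ {e u v} (j : Joins e u v) {t} → t ≢ 0F → arc j t e ≢ 0F
  arc-on {e} (inj₁ _) {t} t≢0 rewrite δ-refl e = t≢0
  arc-on {e} (inj₂ _) {t} t≢0 rewrite δ-refl e = t≢0 ∘ negate t
    where
    negate : ∀ t → - t ≡ 0F → t ≡ 0F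
    negate = toWitness {a? = all? λ _ → _ ≟ _ →-dec _ ≟ _} _

  joins-≢ : ∀ {e u v} → Joins e u v → u ≢ v
  joins-≢ {e} (inj₁ refl) = loopless e
  joins-≢ {e} (inj₂ refl) = loopless e ∘ sym

  joins-unique : ∀ {e u v u′ v′} → Joins e u v → Joins e u′ v′ →
    (u′ ≡ u × v′ ≡ v) ⊎ (u′ ≡ v × v′ ≡ u)
  joins-unique (inj₁ refl) (inj₁ refl) = inj₁ (refl , refl)
  joins-unique (inj₁ refl) (inj₂ refl) = inj₂ (refl , refl)
  joins-unique (inj₂ refl) (inj₁ refl) = inj₂ (refl , refl)
  joins-unique (inj₂ refl) (inj₂ refl) = inj₁ (refl , refl)

  -- Trees built by growth steps

  -- The number k counts the triangles; k = 0 is a single edge, which is not a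
  -- triangle-tree but is the natural base for inductions.
  data Tree : Subset order → Subset size → ℕ → Set where
    base : ∀ {y z h} → Joins h y z → Tree (⁅ y ⁆ ∪ ⁅ z ⁆) ⁅ h ⁆ 0
    grow : ∀ {S T k x y z h f g} → Tree S T k →
      x ∉ S → h ∈ T → Joins h y z → Joins f x y → Joins g x z →
      Tree (⁅ x ⁆ ∪ S) (⁅ f ⁆ ∪ ⁅ g ⁆ ∪ T) (suc k)

  -- The initial triangle is the edge yz with `x` grown on it, which explains the index `suc k`.
  fromTriangleTree : ∀ {S T} → TriangleTree G S T → ∃[ k ] Tree S T (suc k)
  fromTriangleTree (triangle {x} {y} {z} {e} {f} {g} jxy jyz jzx) =
    0 , subst (λ U → Tree _ (⁅ e ⁆ ∪ U) 1) (∪-comm ⁅ g ⁆ ⁅ f ⁆)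
      (grow (base jyz) x∉ (x∈⁅x⁆ f) jyz jxy (swap jzx))
    where
    x∉ : x ∉ ⁅ y ⁆ ∪ ⁅ z ⁆
    x∉ x∈ = [ joins-≢ jxy , (λ x∈z → joins-≢ jzx (sym (x∈⁅y⁆⇒x≡y z x∈z))) ]′ (∈-cons⁻ x∈)
  fromTriangleTree (attach t x∉S h∈T jh jf jg) =
    let k , t′ = fromTriangleTree t in suc k , grow t′ x∉S h∈T jh jf jg

  endpoints : ∀ {S T k e u v} → Tree S T k → e ∈ T → Joins e u v → u ∈ S × v ∈ S
  endpoints {S = S} t e∈T j = ∈S t e∈T j , ∈S t e∈T (swap j)
    where
    either : ∀ {S e u v u′ v′} → Joins e u v → u ∈ S → v ∈ S → Joins e u′ v′ → u′ ∈ S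
    either j u∈ v∈ j′ with joins-unique j j′
    ... | inj₁ (refl , _) = u∈
    ... | inj₂ (refl , _) = v∈
    ∈S : ∀ {S T k e u v} → Tree S T k → e ∈ T → Joins e u v → u ∈ S
    ∈S (base {z = z} {h} jh) e∈T j with refl ← x∈⁅y⁆⇒x≡y h e∈T = either jh ∈-new (∈-old (x∈⁅x⁆ z)) j
    ∈S (grow t x∉S h∈T jh jf jg) e∈T j with ∈-cons⁻ e∈T
    ... | inj₁ refl = either jf ∈-new (∈-old (∈S t h∈T jh)) j
    ... | inj₂ e∈ with ∈-cons⁻ e∈
    ...   | inj₁ refl = either jg ∈-new (∈-old (∈S t h∈T (swap jh))) j
    ...   | inj₂ e∈T′ = ∈-old (∈S t e∈T′ j)

  new-edge∉ : ∀ {S T k e x y} → Tree S T k → x ∉ S → Joins e x y → e ∉ T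
  new-edge∉ t x∉S j e∈T = x∉S (proj₁ (endpoints t e∈T j))

  new-edges-≢ : ∀ {S T k x y z h f g} → Tree S T k → x ∉ S → h ∈ T →
    Joins h y z → Joins f x y → Joins g x z → f ≢ g
  new-edges-≢ t x∉S h∈T jh jf jg refl with joins-unique jf jg
  ... | inj₁ (_ , refl) = joins-≢ jh refl
  ... | inj₂ (refl , _) = x∉S (proj₁ (endpoints t h∈T jh))

  -- The nowhere-zero condition is waived on the edges satisfying P.
  record Carries (P : Edge → Set) (T : Subset size) (f : Flow) : Set where
    field
      off : ∀ {e} → e ∉ T → f e ≡ 0F
      on  : ∀ {e} → e ∈ T → ¬ P e → f e ≢ 0F
  open Carries

  Orients : Subset size → Flow → Set
  Orients = Carries (λ _ → ⊥)

  module Grow {S T k x y z h f g} (tr : Tree S T k) (x∉S : x ∉ S) (h∈T : h ∈ T)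
              (jh : Joins h y z) (jf : Joins f x y) (jg : Joins g x z) where
    f≢g = new-edges-≢ tr x∉S h∈T jh jf jg
    f∉T = new-edge∉ tr x∉S jf
    g∉T = new-edge∉ tr x∉S jg

    y∈S = proj₁ (endpoints tr h∈T jh)
    z∈S = proj₂ (endpoints tr h∈T jh)

    module _ {φ : Flow} (φ-off : ∀ {e} → e ∉ T → φ e ≡ 0F) (s t : Fin 3) where
      φ′ = φ ⊞ arc jf s ⊞ arc jg t

      at-old : ∀ {e} → e ∈ T → φ′ e ≡ φ e
      at-old {e} e∈T = begin
        φ e + arc jf s e + arc jg t e ≡⟨ cong₂ (λ a b → φ e + a + b)
                                           (arc-off jf s λ { refl → f∉T e∈T })
                                           (arc-off jg t λ { refl → g∉T e∈T }) ⟩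
        φ e + 0F + 0F                 ≡⟨ +-identityʳ _ ⟩
        φ e + 0F                      ≡⟨ +-identityʳ _ ⟩
        φ e                           ∎

      at-f : φ′ f ≡ arc jf s f
      at-f = trans (cong₂ (λ a b → a + arc jf s f + b) (φ-off f∉T) (arc-off jg t (f≢g ∘ sym)))
                   (+-identityʳ _)

      at-g : φ′ g ≡ arc jg t g
      at-g = cong₂ (λ a b → a + b + arc jg t g) (φ-off g∉T) (arc-off jf s f≢g)

    carries : ∀ {P φ s t} → Carries P T φ → (¬ P f → s ≢ 0F) → (¬ P g → t ≢ 0F) →
      Carries P (⁅ f ⁆ ∪ ⁅ g ⁆ ∪ T) (φ ⊞ arc jf s ⊞ arc jg t)
    carries {P} {φ} {s} {t} c s≢0 t≢0 = record { off = off′ ; on = on′ }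
      where
      off′ : ∀ {e} → e ∉ ⁅ f ⁆ ∪ ⁅ g ⁆ ∪ T → (φ ⊞ arc jf s ⊞ arc jg t) e ≡ 0F
      off′ e∉ = cong₂ _+_
        (cong₂ _+_ (off c (e∉ ∘ ∈-old ∘ ∈-old)) (arc-off jf s λ { refl → e∉ ∈-new }))
        (arc-off jg t λ { refl → e∉ (∈-old ∈-new) })
      on′ : ∀ {e} → e ∈ ⁅ f ⁆ ∪ ⁅ g ⁆ ∪ T → ¬ P e → (φ ⊞ arc jf s ⊞ arc jg t) e ≢ 0F
      on′ e∈ ¬Pe with ∈-cons⁻ e∈
      ... | inj₁ refl = arc-on jf (s≢0 ¬Pe) ∘ trans (sym (at-f (off c) s t))
      ... | inj₂ e∈ with ∈-cons⁻ e∈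
      ...   | inj₁ refl = arc-on jg (t≢0 ¬Pe) ∘ trans (sym (at-g (off c) s t))
      ...   | inj₂ e∈T  = on c e∈T ¬Pe ∘ trans (sym (at-old (off c) s t e∈T))

  grow-∂ : ∀ {x y z f g} φ (jf : Joins f x y) (jg : Joins g x z) s t v →
    ∂ (φ ⊞ arc jf s ⊞ arc jg t) v ≡ ∂ φ v + s * (δ x v - δ y v) + t * (δ x v - δ z v)
  grow-∂ φ jf jg s t v = begin
    ∂ (φ ⊞ arc jf s ⊞ arc jg t) v                  ≡⟨ ∂-⊞ (φ ⊞ arc jf s) _ v ⟩
    ∂ (φ ⊞ arc jf s) v + ∂ (arc jg t) v            ≡⟨ cong₂ _+_ (∂-⊞ φ _ v) (∂-arc jg t v) ⟩
    ∂ φ v + ∂ (arc jf s) v + _                     ≡⟨ cong (λ c → ∂ φ v + c + _) (∂-arc jf s v) ⟩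
    ∂ φ v + s * _ + t * _                          ∎

  -- The added arc is supported on `h` alone. This turns a flow exempt at `h` into a full
  -- orientation once the new value at `h` is nonzero.
  patch : ∀ {T h y z φ} (jh : Joins h y z) c → Carries (_≡ h) T φ → h ∈ T →
    (φ ⊞ arc jh c) h ≢ 0F → Orients T (φ ⊞ arc jh c)
  patch {h = h} {φ = φ} jh c ca h∈T ≢0 = record
    { off = λ e∉T → cong₂ _+_ (off ca e∉T) (arc-off jh c λ { refl → e∉T h∈T })
    ; on  = on′ }
    where
    on′ : ∀ {e} → e ∈ _ → ¬ ⊥ → (φ ⊞ arc jh c) e ≢ 0F
    on′ {e} e∈T _ with e ≟ h
    ... | yes refl = ≢0
    ... | no e≢h   = on ca e∈T e≢h ∘
      trans (sym (trans (cong (φ e +_) (arc-off jh c (e≢h ∘ sym))) (+-identityʳ _)))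

  -- Boundaries realised by a single tree

  record Demand (S : Subset order) (m : Charge) : Set where
    field
      support  : ∀ {v} → v ∉ S → m v ≡ 0F
      balanced : sum m ≡ 0F
  open Demand

  demand-cong : ∀ {S m m′} → m ≗ m′ → Demand S m → Demand S m′
  demand-cong m≗m′ d = record
    { support  = λ v∉S → trans (sym (m≗m′ _)) (support d v∉S)
    ; balanced = trans (sym (sum-cong-≗ m≗m′)) (balanced d) }

  -- The charge left for the smaller tree when the edges xy and xz carry `s` and `t` away from `x`.
  -- It vanishes at `x` exactly if `s + t ≡ m x`.
  detach : Vertex → Vertex → Vertex → Fin 3 → Fin 3 → Charge → Charge
  detach x y z s t m v = m v + - s * (δ x v - δ y v) + - t * (δ x v - δ z v)

  demand-detach : ∀ {S x y z m} s t → x ∉ S → y ∈ S → z ∈ S →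
    Demand (⁅ x ⁆ ∪ S) m → s + t ≡ m x → Demand S (detach x y z s t m)
  demand-detach {S} {x} {y} {z} {m} s t x∉S y∈S z∈S d s+t≡mx = record { support = support′ ; balanced = balanced′ }
    where
    ≢-by : ∀ {u v} → u ∈ S → v ∉ S → u ≢ v
    ≢-by u∈S v∉S refl = v∉S u∈S
    evaluate : ∀ {m m′ a a′ b b′ c c′} → m ≡ m′ → a ≡ a′ → b ≡ b′ → c ≡ c′ →
      m + - s * (a - b) + - t * (a - c) ≡ m′ + - s * (a′ - b′) + - t * (a′ - c′)
    evaluate refl refl refl refl = refl
    at-x : ∀ s t → s + t + - s * (1F - 0F) + - t * (1F - 0F) ≡ 0F
    at-x = toWitness {a? = all? λ _ → all? λ _ → _ ≟ _} _
    away : ∀ s t → 0F + - s * (0F - 0F) + - t * (0F - 0F) ≡ 0F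
    away = toWitness {a? = all? λ _ → all? λ _ → _ ≟ _} _
    support′ : ∀ {v} → v ∉ S → detach x y z s t m v ≡ 0F
    support′ {v} v∉S with v ≟ x
    ... | yes refl = trans
      (evaluate (sym s+t≡mx) (δ-refl x) (δ-≢ (≢-by y∈S v∉S)) (δ-≢ (≢-by z∈S v∉S))) (at-x s t)
    ... | no v≢x = trans
      (evaluate (support d ([ v≢x , v∉S ]′ ∘ ∈-cons⁻)) (δ-≢ (v≢x ∘ sym))
        (δ-≢ (≢-by y∈S v∉S)) (δ-≢ (≢-by z∈S v∉S))) (away s t)
    balanced′ : sum (detach x y z s t m) ≡ 0F
    balanced′ = begin
      sum (detach x y z s t m)
        ≡⟨ ∑-distrib-+ (λ v → m v + - s * (δ x v - δ y v)) (λ v → - t * (δ x v - δ z v)) ⟩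
      sum (λ v → m v + - s * (δ x v - δ y v)) + sum (λ v → - t * (δ x v - δ z v))
        ≡⟨ cong₂ _+_ (∑-distrib-+ m (λ v → - s * (δ x v - δ y v))) (sum-dipole (- t) x z) ⟩
      sum m + sum (λ v → - s * (δ x v - δ y v)) + 0F
        ≡⟨ cong₂ (λ a b → a + b + 0F) (balanced d) (sum-dipole (- s) x y) ⟩
      0F ∎

  -- Zero sum on two vertices forces `m z` to be the negative of `m y`, so the charge is a multiple
  -- of one dipole.
  demand-edge : ∀ {y z m} → y ≢ z → Demand (⁅ y ⁆ ∪ ⁅ z ⁆) m → ∀ v → m v ≡ m y * (δ y v - δ z v)
  demand-edge {y} {z} {m} y≢z d v = antisymmetric (m v) (m y) (m z) (δ y v) (δ z v) opposite (expand v)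
    where
    expand : ∀ v → m v ≡ δ y v * m y + δ z v * m z
    expand v with v ≟ y | v ≟ z
    ... | yes refl | _ rewrite δ-refl v | δ-≢ (y≢z ∘ sym) = sym (+-identityʳ _)
    ... | no _ | yes refl rewrite δ-refl v | δ-≢ y≢z = refl
    ... | no v≢y | no v≢z rewrite δ-≢ (v≢y ∘ sym) | δ-≢ (v≢z ∘ sym) =
      support d ([ v≢y , v≢z ∘ x∈⁅y⁆⇒x≡y z ]′ ∘ ∈-cons⁻)
    opposite : m y + m z ≡ 0F
    opposite = begin
      m y + m z                                             ≡⟨ cong₂ _+_ (sum-δ y (λ _ → m y)) (sum-δ z (λ _ → m z)) ⟨
      sum (λ v → δ y v * m y) + sum (λ v → δ z v * m z)     ≡⟨ ∑-distrib-+ (λ v → δ y v * m y) (λ v → δ z v * m z) ⟨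
      sum (λ v → δ y v * m y + δ z v * m z)                 ≡⟨ sum-cong-≗ expand ⟨
      sum m                                                 ≡⟨ balanced d ⟩
      0F                                                    ∎
    antisymmetric : ∀ w a b p q → a + b ≡ 0F → w ≡ p * a + q * b → w ≡ a * (p - q)
    antisymmetric = toWitness {a? = all? λ _ → all? λ _ → all? λ _ → all? λ _ → all? λ _ →
      _ ≟ _ →-dec (_ ≟ _ →-dec _ ≟ _)} _

  -- Abstract, as otherwise the unifier unfolds the decision procedures.
  abstract
    split-nonzero : ∀ a → ∃₂ λ s t → s + t ≡ a × s ≢ 0F × t ≢ 0F
    split-nonzero = toWitness {a? = all? λ _ → any? λ _ → any? λ _ →
      _ ≟ _ ×-dec ¬? (_ ≟ _) ×-dec ¬? (_ ≟ _)} _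

  reattach : ∀ m s t a b c → m + - s * (a - b) + - t * (a - c) + s * (a - b) + t * (a - c) ≡ m
  reattach = toWitness {a? = all? λ _ → all? λ _ → all? λ _ → all? λ _ → all? λ _ → all? λ _ → _ ≟ _} _

  grow-realizes : ∀ {x y z f g m} φ (jf : Joins f x y) (jg : Joins g x z) s t →
    ∂ φ ≗ detach x y z s t m → ∂ (φ ⊞ arc jf s ⊞ arc jg t) ≗ m
  grow-realizes {x} {y} {z} {m = m} φ jf jg s t eq v = begin
    ∂ (φ ⊞ arc jf s ⊞ arc jg t) v                             ≡⟨ grow-∂ φ jf jg s t v ⟩
    ∂ φ v + s * (δ x v - δ y v) + t * (δ x v - δ z v)         ≡⟨ cong (λ c → c + s * _ + t * _) (eq v) ⟩
    detach x y z s t m v + s * (δ x v - δ y v) + t * (δ x v - δ z v)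
      ≡⟨ reattach (m v) s t (δ x v) (δ y v) (δ z v) ⟩
    m v                                                       ∎

  -- Pushing c around the triangle x z y leaves ∂ unchanged.
  rotate-realizes : ∀ {x y z h f g m} φ (jh : Joins h y z) (jf : Joins f x y) (jg : Joins g x z) s t c →
    ∂ φ ≗ detach x y z s t m →
    ∂ (φ ⊞ arc jh (- c) ⊞ arc jf (s - c) ⊞ arc jg (t + c)) ≗ m
  rotate-realizes {x} {y} {z} {m = m} φ jh jf jg s t c eq =
    grow-realizes (φ ⊞ arc jh (- c)) jf jg (s - c) (t + c) λ v → begin
    ∂ (φ ⊞ arc jh (- c)) v                              ≡⟨ ∂-⊞ φ (arc jh (- c)) v ⟩
    ∂ φ v + ∂ (arc jh (- c)) v                          ≡⟨ cong₂ _+_ (eq v) (∂-arc jh (- c) v) ⟩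
    detach x y z s t m v + - c * (δ y v - δ z v)        ≡⟨ rotate (m v) s t c (δ x v - δ y v) (δ x v - δ z v) _
                                                             (difference (δ x v) (δ y v) (δ z v)) ⟩
    detach x y z (s - c) (t + c) m v                    ∎
    where
    difference : ∀ a b c → b - c ≡ a - c - (a - b)
    difference = toWitness {a? = all? λ _ → all? λ _ → all? λ _ → _ ≟ _} _
    linear : ∀ s t c p q → - s * p + (- t * q + - c * (q - p)) ≡ - (s - c) * p + - (t + c) * q
    linear = toWitness {a? = all? λ _ → all? λ _ → all? λ _ → all? λ _ → all? λ _ → _ ≟ _} _
    rotate : ∀ m s t c p q r → r ≡ q - p →
      m + - s * p + - t * q + - c * r ≡ m + - (s - c) * p + - (t + c) * q
    rotate m s t c p q _ refl = begin
      m + - s * p + - t * q + - c * (q - p)     ≡⟨ +-assoc (m + - s * p) _ _ ⟩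
      m + - s * p + (- t * q + - c * (q - p))   ≡⟨ +-assoc m _ _ ⟩
      m + (- s * p + (- t * q + - c * (q - p))) ≡⟨ cong (m +_) (linear s t c p q) ⟩
      m + (- (s - c) * p + - (t + c) * q)       ≡⟨ +-assoc m _ _ ⟨
      m + - (s - c) * p + - (t + c) * q         ∎

  abstract
    -- Each of the two inequalities excludes just one of the three values of `c`, so a value
    -- remains.
    choose-arc : ∀ {h y z} (jh : Joins h y z) a d → d ≢ 0F →
      ∃[ c ] d + c ≢ 0F × a + arc jh (- c) h ≢ 0F
    choose-arc {h} (inj₁ _) a d d≢0 rewrite δ-refl h = choose a d d≢0
      where
      choose : ∀ a d → d ≢ 0F → ∃[ c ] d + c ≢ 0F × a + - c ≢ 0F
      choose = toWitness {a? = all? λ _ → all? λ _ → ¬? (_ ≟ _) →-dec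
        any? λ _ → ¬? (_ ≟ _) ×-dec ¬? (_ ≟ _)} _
    choose-arc {h} (inj₂ _) a d d≢0 rewrite δ-refl h = choose a d d≢0
      where
      choose : ∀ a d → d ≢ 0F → ∃[ c ] d + c ≢ 0F × a + - (- c) ≢ 0F
      choose = toWitness {a? = all? λ _ → all? λ _ → ¬? (_ ≟ _) →-dec
        any? λ _ → ¬? (_ ≟ _) ×-dec ¬? (_ ≟ _)} _

  Realizes-on : (Edge → Set) → Subset size → Charge → Set
  Realizes-on P T m = Σ[ φ ∈ Flow ] Carries P T φ × ∂ φ ≗ m

  relax : ∀ {P T φ} → Orients T φ → Carries P T φ
  relax o = record { off = off o ; on = λ e∈T _ → on o e∈T λ () }

  base-realizes : ∀ {y z h m} (jh : Joins h y z) → Demand (⁅ y ⁆ ∪ ⁅ z ⁆) m → ∂ (arc jh (m y)) ≗ m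
  base-realizes {y} {m = m} jh d v = trans (∂-arc jh (m y) v) (sym (demand-edge (joins-≢ jh) d v))

  base-carries : ∀ {P y z h} (jh : Joins h y z) {t} → (¬ P h → t ≢ 0F) → Carries P ⁅ h ⁆ (arc jh t)
  base-carries {h = h} jh {t} t≢0 = record
    { off = λ e∉ → arc-off jh t λ { refl → e∉ (x∈⁅x⁆ h) }
    ; on  = λ {e} e∈ ¬Pe → on′ e (x∈⁅y⁆⇒x≡y h e∈) ¬Pe }
    where
    on′ : ∀ e → e ≡ h → ¬ _ → arc jh t e ≢ 0F
    on′ _ refl ¬Pe = arc-on jh (t≢0 ¬Pe)

  -- With `f` exempt only `g` and `h` must be nonzero at the end. The smaller tree is solved with
  -- `h` exempt, and one rotation of the new triangle then makes both nonzero.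
  exempt-new : ∀ {S T k x y z h f g m} → Tree S T k → x ∉ S → h ∈ T →
    Joins h y z → Joins f x y → Joins g x z →
    (∀ {m} → Demand S m → Realizes-on (_≡ h) T m) →
    Demand (⁅ x ⁆ ∪ S) m → Realizes-on (_≡ f) (⁅ f ⁆ ∪ ⁅ g ⁆ ∪ T) m
  exempt-new {x = x} {h = h} {m = m} tr x∉S h∈T jh jf jg realize d =
    -- The edge `g` starts with 1 and `f` takes whatever remains, possibly zero.
    let s = m x - 1F
        φ , c-φ , ∂φ = realize (demand-detach s 1F x∉S y∈S z∈S d (restore (m x)))
        c , 1+c≢0 , φh≢0 = choose-arc jh (φ h) 1F λ ()
    in φ ⊞ arc jh (- c) ⊞ arc jf (s - c) ⊞ arc jg (1F + c)
     , carries (relax (patch jh (- c) c-φ h∈T φh≢0)) (λ f≢f → contradiction refl f≢f) (λ _ → 1+c≢0)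
     , rotate-realizes φ jh jf jg s 1F c ∂φ
    where
    open Grow tr x∉S h∈T jh jf jg
    restore : ∀ a → a - 1F + 1F ≡ a
    restore = toWitness {a? = all? λ _ → _ ≟ _} _

  -- Waiving one edge removes the obstruction altogether. If the exempt edge is new, `exempt-new`
  -- applies; if it is old, `m x` is split into two nonzero parts and the exemption is passed down.
  realize-exempt : ∀ {S T k m e} → Tree S T k → e ∈ T → Demand S m → Realizes-on (_≡ e) T m
  realize-exempt {m = m} (base {y} {h = h} jh) e∈ d with refl ← x∈⁅y⁆⇒x≡y h e∈ =
    arc jh (m y) , base-carries jh (contradiction refl) , base-realizes jh d
  realize-exempt {m = m} (grow {x = x} tr x∉S h∈T jh jf jg) e∈ d with ∈-cons⁻ e∈
  ... | inj₁ refl = exempt-new tr x∉S h∈T jh jf jg (realize-exempt tr h∈T) d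
  ... | inj₂ e∈ with ∈-cons⁻ e∈
  -- The case of `g` mirrors that of `f`, with the roles of `y` and `z` exchanged.
  ...   | inj₁ refl = subst (λ U → Realizes-on _ U m) (∪-swap _ _ _)
    (exempt-new tr x∉S h∈T (swap jh) jg jf (realize-exempt tr h∈T) d)
  ...   | inj₂ e∈T =
    let open Grow tr x∉S h∈T jh jf jg
        s , t , s+t , s≢0 , t≢0 = split-nonzero (m x)
        φ , c-φ , ∂φ = realize-exempt tr e∈T (demand-detach s t x∉S y∈S z∈S d s+t)
    in φ ⊞ arc jf s ⊞ arc jg t , carries c-φ (λ _ → s≢0) (λ _ → t≢0) , grow-realizes φ jf jg s t ∂φ

  -- Triangle coefficients and the obstruction

  indicator : Vertex → Vertex → Vertex → Charge
  indicator x y z v = δ x v + δ y v + δ z v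

  drop : Vertex → Vertex → Vertex → Charge → Charge
  drop x y z m v = m v - m x * indicator x y z v

  -- A nonzero `m x` splits into two nonzero parts only as `- m x` plus `- m x`. Hence `drop` is
  -- then the only charge that the smaller tree can be left with.
  drop≗detach : ∀ x y z m → drop x y z m ≗ detach x y z (- m x) (- m x) m
  drop≗detach x y z m v = expand (m v) (m x) (δ x v) (δ y v) (δ z v)
    where
    expand : ∀ m s a b c → m - s * (a + b + c) ≡ m + - (- s) * (a - b) + - (- s) * (a - c)
    expand = toWitness {a? = all? λ _ → all? λ _ → all? λ _ → all? λ _ → all? λ _ → _ ≟ _} _

  -- m = Σⱼ coeff m j · (indicator of the j-th triangle) + residue m, where the
  -- coefficients are read off at the vertices of the tree, the last one first.
  coeff : ∀ {S T k} → Tree S T k → Charge → Fin k → Fin 3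
  coeff (grow {x = x} _ _ _ _ _ _) m zero = m x
  coeff (grow {x = x} {y} {z} tr _ _ _ _ _) m (suc j) = coeff tr (drop x y z m) j

  residue : ∀ {S T k} → Tree S T k → Charge → Charge
  residue (base _) m = m
  residue (grow {x = x} {y} {z} tr _ _ _ _ _) m = residue tr (drop x y z m)

  triangle-at : ∀ {S T k} → Tree S T k → Fin k → Charge
  triangle-at (grow {x = x} {y} {z} _ _ _ _ _ _) zero = indicator x y z
  triangle-at (grow tr _ _ _ _ _) (suc j) = triangle-at tr j

  decompose : ∀ {S T k} (tr : Tree S T k) m v →
    m v ≡ sum (λ j → coeff tr m j * triangle-at tr j v) + residue tr m v
  decompose (base _) m v = refl
  decompose (grow {x = x} {y} {z} tr _ _ _ _ _) m v =
    trans (move (m v) (m x * indicator x y z v) _ (decompose tr (drop x y z m) v))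
          (sym (+-assoc (m x * indicator x y z v) _ _))
    where
    move : ∀ a b c → a - b ≡ c → a ≡ b + c
    move = toWitness {a? = all? λ _ → all? λ _ → all? λ _ → _ ≟ _ →-dec _ ≟ _} _

  -- The corners of a triangle are distinct since no edge is a loop, so triangle indicators are the
  -- 0/1 vectors required by `two-coefficients`.
  triangle-at-≢2 : ∀ {S T k} (tr : Tree S T k) j v → triangle-at tr j v ≢ 2F
  triangle-at-≢2 (grow {S} {x = x} {y} {z} tr x∉S h∈T jh jf jg) zero v = at-most-one
    where
    at-most-one : indicator x y z v ≢ 2F
    at-most-one with x ≟ v | y ≟ v | z ≟ v
    ... | yes refl | yes refl | _        = contradiction refl (joins-≢ jf)
    ... | yes refl | no _     | yes refl = contradiction refl (joins-≢ jg)
    ... | yes _    | no _     | no _     = λ ()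
    ... | no _     | yes refl | yes refl = contradiction refl (joins-≢ jh)
    ... | no _     | yes _    | no _     = λ ()
    ... | no _     | no _     | yes _    = λ ()
    ... | no _     | no _     | no _     = λ ()
  triangle-at-≢2 (grow tr _ _ _ _ _) (suc j) v = triangle-at-≢2 tr j v

  drop-cong : ∀ x y z {m m′} → m ≗ m′ → drop x y z m ≗ drop x y z m′
  drop-cong x y z eq v = cong₂ (λ a b → a - b * indicator x y z v) (eq v) (eq x)

  drop-axpy : ∀ x y z m c w →
    drop x y z (λ v → m v + c * w v) ≗ λ v → drop x y z m v + c * drop x y z w v
  drop-axpy x y z m c w v = expand (m v) (w v) (m x) (w x) c (indicator x y z v)
    where
    expand : ∀ m w a b c d → m + c * w - (a + c * b) * d ≡ m - a * d + c * (w - b * d)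
    expand = toWitness {a? = all? λ _ → all? λ _ → all? λ _ → all? λ _ → all? λ _ → all? λ _ → _ ≟ _} _

  ∘drop-linear : ∀ x y z {φ} → Linear φ → Linear (φ ∘ drop x y z)
  ∘drop-linear x y z {φ} linear = record
    { ≗-cong = ≗-cong ∘ drop-cong x y z
    ; axpy   = λ m c w → trans (≗-cong (drop-axpy x y z m c w)) (axpy _ c _) }
    where open Linear linear

  evaluation-linear : ∀ v → Linear {order} (λ m → m v)
  evaluation-linear v = record { ≗-cong = λ eq → eq v ; axpy = λ _ _ _ → refl }

  coeff-linear : ∀ {S T k} (tr : Tree S T k) j → Linear (λ m → coeff tr m j)
  coeff-linear (grow {x = x} _ _ _ _ _ _) zero = evaluation-linear x
  coeff-linear (grow {x = x} {y} {z} tr _ _ _ _ _) (suc j) = ∘drop-linear x y z (coeff-linear tr j)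

  residue-linear : ∀ {S T k} (tr : Tree S T k) v → Linear (λ m → residue tr m v)
  residue-linear (base _) v = evaluation-linear v
  residue-linear (grow {x = x} {y} {z} tr _ _ _ _ _) v = ∘drop-linear x y z (residue-linear tr v)

  Obstructed : ∀ {S T k} → Tree S T k → Charge → Set
  Obstructed tr m = (∀ j → coeff tr m j ≢ 0F) × (∀ v → residue tr m v ≡ 0F)

  -- If `m x` is zero, the new edges carry opposite values, and one rotation makes them and `h`
  -- nonzero. Otherwise the split at `x` is forced, and the alternative is inherited from
  -- `drop x y z m` on the smaller tree. A single edge fails only for charge zero.
  realize-or-obstructed : ∀ {S T k m} (tr : Tree S T k) → Demand S m →
    Realizes-on (λ _ → ⊥) T m ⊎ Obstructed tr m
  realize-or-obstructed {m = m} (base {y} {z} jh) d with m y ≟ 0F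
  ... | no my≢0  = inj₁ (arc jh (m y) , base-carries jh (λ _ → my≢0) , base-realizes jh d)
  ... | yes my≡0 = inj₂ ((λ ()) , λ v →
    trans (demand-edge (joins-≢ jh) d v) (cong (_* (δ y v - δ z v)) my≡0))
  realize-or-obstructed {m = m} (grow {x = x} {y} {z} {h} tr x∉S h∈T jh jf jg) d with m x ≟ 0F
  ... | yes mx≡0 =
    let s , t , s+t , s≢0 , t≢0 = split-nonzero (m x)
        φ , c-φ , ∂φ = realize-exempt tr h∈T (demand-detach s t x∉S y∈S z∈S d s+t)
        c , t+c≢0 , φh≢0 = choose-arc jh (φ h) t t≢0
    in inj₁ (φ ⊞ arc jh (- c) ⊞ arc jf (s - c) ⊞ arc jg (t + c)
       -- From `s + t ≡ 0F` follows that `s - c` is the negative of `t + c`, so both are nonzero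
       -- together.
       , carries (patch jh (- c) c-φ h∈T φh≢0) (λ _ → opposite s t c (trans s+t mx≡0) t+c≢0) (λ _ → t+c≢0)
       , rotate-realizes φ jh jf jg s t c ∂φ)
    where
    open Grow tr x∉S h∈T jh jf jg
    opposite : ∀ s t c → s + t ≡ 0F → t + c ≢ 0F → s - c ≢ 0F
    opposite = toWitness {a? = all? λ _ → all? λ _ → all? λ _ →
      _ ≟ _ →-dec (¬? (_ ≟ _) →-dec ¬? (_ ≟ _))} _
  ... | no mx≢0 with realize-or-obstructed tr (demand-cong (sym ∘ drop≗detach x y z m)
                       (demand-detach (- m x) (- m x) x∉S y∈S z∈S d (double (m x))))
    where
    open Grow tr x∉S h∈T jh jf jg
    double : ∀ a → - a + - a ≡ a
    double = toWitness {a? = all? λ _ → _ ≟ _} _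
  ...   | inj₁ (φ , o , ∂φ) = inj₁
    ( φ ⊞ arc jf (- m x) ⊞ arc jg (- m x)
    , Grow.carries tr x∉S h∈T jh jf jg o (λ _ → -‿≢0 (m x) mx≢0) (λ _ → -‿≢0 (m x) mx≢0)
    , grow-realizes φ jf jg (- m x) (- m x) (λ v → trans (∂φ v) (drop≗detach x y z m v)))
  ...   | inj₂ (coeff≢0 , residue≡0) = inj₂ ((λ { zero → mx≢0 ; (suc j) → coeff≢0 j }) , residue≡0)

  -- Strongly connected orientations of a tree

  FlowArc : Flow → Vertex → Vertex → Set
  FlowArc φ u v = ∃[ e ] (ends e ≡ (u , v) × φ e ≡ 1F ⊎ ends e ≡ (v , u) × φ e ≡ 2F)

  forward : ∀ {φ e u v} (j : Joins e u v) → φ e ≡ arc j 1F e → FlowArc φ u v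
  forward {e = e} (inj₁ p) eq rewrite δ-refl e = e , inj₁ (p , eq)
  forward {e = e} (inj₂ p) eq rewrite δ-refl e = e , inj₂ (p , eq)

  backward : ∀ {φ e u v} (j : Joins e u v) → φ e ≡ arc j 2F e → FlowArc φ v u
  backward {e = e} (inj₁ p) eq rewrite δ-refl e = e , inj₂ (p , eq)
  backward {e = e} (inj₂ p) eq rewrite δ-refl e = e , inj₁ (p , eq)

  -- Agreement is asked only where `φ` is nonzero, which suffices to preserve its directed arcs.
  _Extends_ : Flow → Flow → Set
  ψ Extends φ = ∀ {e} → φ e ≢ 0F → ψ e ≡ φ e

  extend-arc : ∀ {φ ψ u v} → ψ Extends φ → FlowArc φ u v → FlowArc ψ u v
  extend-arc ext (e , inj₁ (p , eq)) =
    e , inj₁ (p , trans (ext λ φe≡0 → contradiction (trans (sym eq) φe≡0) λ ()) eq)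
  extend-arc ext (e , inj₂ (p , eq)) =
    e , inj₂ (p , trans (ext λ φe≡0 → contradiction (trans (sym eq) φe≡0) λ ()) eq)

  -- Strong connectivity through a root, so that a new vertex needs just one path in and one path
  -- out.
  Connected : Subset order → Flow → Set
  Connected S φ = ∃[ r ] (∀ {u} → u ∈ S → Star (FlowArc φ) r u × Star (FlowArc φ) u r)

  extend-connected : ∀ {S φ ψ} → ψ Extends φ → Connected S φ → Connected S ψ
  extend-connected {φ = φ} {ψ} ext (r , to-from) = r , λ u∈S →
    let to , from = to-from u∈S in Star-map lift to , Star-map lift from
    where
    lift : ∀ {u v} → FlowArc φ u v → FlowArc ψ u v
    lift = extend-arc {φ} {ψ} ext

  add-detour : ∀ {S φ x y z} → Connected S φ → y ∈ S → z ∈ S →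
    FlowArc φ y x → FlowArc φ x z → Connected (⁅ x ⁆ ∪ S) φ
  add-detour {S} {φ} {x} (r , to-from) y∈S z∈S yx xz = r , λ u∈ → both (∈-cons⁻ u∈)
    where
    both : ∀ {u} → u ≡ x ⊎ u ∈ S → Star (FlowArc φ) r u × Star (FlowArc φ) u r
    both (inj₁ refl) = proj₁ (to-from y∈S) ◅◅ yx ◅ ε , xz ◅ proj₂ (to-from z∈S)
    both (inj₂ u∈S)  = to-from u∈S

  dipole : Vertex → Vertex → Charge
  dipole y z v = δ y v - δ z v

  -- The edges to which the second and later triangles are attached, the last one first.
  spine : ∀ {S T k} → Tree S T (suc k) → Fin k → Vertex × Vertex
  spine (grow {y = y} {z} (grow _ _ _ _ _ _) _ _ _ _ _) zero    = y , z
  spine (grow tr@(grow _ _ _ _ _ _) _ _ _ _ _)          (suc i) = spine tr i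

  spine-≢ : ∀ {S T k} (tr : Tree S T (suc k)) i → uncurry _≢_ (spine tr i)
  spine-≢ (grow (grow _ _ _ _ _ _) _ _ jh _ _)    zero    = joins-≢ jh
  spine-≢ (grow tr@(grow _ _ _ _ _ _) _ _ _ _ _) (suc i) = spine-≢ tr i

  spine-dipole : ∀ {S T k} → Tree S T (suc k) → Fin k → Charge
  spine-dipole tr i = uncurry dipole (spine tr i)

  -- Every triangle after the first is traversed as a directed path parallel to its spine edge.
  connected-orientation : ∀ {S T k} (tr : Tree S T (suc k)) (σ : Signs k) →
    Σ[ φ ∈ Flow ] Orients T φ × (∂ φ ≗ λ v → sum (λ i → proj₁ σ i * spine-dipole tr i v)) × Connected S φ
  connected-orientation (grow {x = x} {y} {z} {h} {f} {g} tr@(base {y′} {z′} {h′} jh′) x∉S h∈T jh jf jg) _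
    with refl ← x∈⁅y⁆⇒x≡y h′ h∈T =
    -- The values 1, 1, 2 on yz, xy, xz form the directed cycle x → y → z → x, whose boundary is
    -- zero.
    φ₀ ⊞ arc jf 1F ⊞ arc jg 2F , carries c (λ _ ()) (λ _ ()) , circulation , x , to-from ∘ ∈-cons⁻
    where
    open Grow tr x∉S h∈T jh jf jg
    φ₀ = arc jh 1F
    c : Orients ⁅ h ⁆ φ₀
    c = base-carries jh (λ _ ())
    φ = φ₀ ⊞ arc jf 1F ⊞ arc jg 2F
    cancel : ∀ a b c → 1F * (b - c) + 1F * (a - b) + 2F * (a - c) ≡ 0F
    cancel = toWitness {a? = all? λ _ → all? λ _ → all? λ _ → _ ≟ _} _
    circulation : ∂ φ ≗ λ _ → 0F
    circulation v = trans (grow-∂ φ₀ jf jg 1F 2F v)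
      (trans (cong (λ a → a + 1F * dipole x y v + 2F * dipole x z v) (∂-arc jh 1F v))
        (cancel (δ x v) (δ y v) (δ z v)))
    xy = forward {φ} jf (at-f (off c) 1F 2F)
    yz = forward {φ} jh (at-old (off c) 1F 2F h∈T)
    zx = backward {φ} jg (at-g (off c) 1F 2F)
    ends-of-h : ∀ {u} → u ∈ ⁅ y′ ⁆ ∪ ⁅ z′ ⁆ → u ≡ y ⊎ u ≡ z
    ends-of-h u∈ with joins-unique jh jh′ | ∈-cons⁻ u∈
    ... | inj₁ (refl , refl) | inj₁ u≡y = inj₁ u≡y
    ... | inj₁ (refl , refl) | inj₂ u∈z = inj₂ (x∈⁅y⁆⇒x≡y z u∈z)
    ... | inj₂ (refl , refl) | inj₁ u≡z = inj₂ u≡z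
    ... | inj₂ (refl , refl) | inj₂ u∈y = inj₁ (x∈⁅y⁆⇒x≡y y u∈y)
    to-from : ∀ {u} → u ≡ x ⊎ u ∈ ⁅ y′ ⁆ ∪ ⁅ z′ ⁆ → Star (FlowArc φ) x u × Star (FlowArc φ) u x
    to-from (inj₁ refl) = ε , ε
    to-from (inj₂ u∈) with ends-of-h u∈
    ... | inj₁ refl = xy ◅ ε , yz ◅ zx ◅ ε
    ... | inj₂ refl = xy ◅ yz ◅ ε , zx ◅ ε
  connected-orientation {S} (grow {S′} {T′} {x = x} {y} {z} {f = f} {g} tr@(grow _ _ _ _ _ _) x∉S h∈T jh jf jg)
      (σ , σ≢0)
    with φ₀ , c , ∂φ₀ , connected ← connected-orientation tr (σ ∘ suc , σ≢0 ∘ suc) =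
    -- The new edges form the path y → x → z for sign 1 and z → x → y for sign 2, which adds
    -- `σ zero` times the dipole of y and z to the boundary.
    φ , carries c (λ _ → -‿≢0 (σ zero) (σ≢0 zero)) (λ _ → σ≢0 zero) , boundary
    , detour (σ zero) (σ≢0 zero) refl
    where
    open Grow tr x∉S h∈T jh jf jg
    φ = φ₀ ⊞ arc jf (- σ zero) ⊞ arc jg (σ zero)
    collect : ∀ s e a b c → s + - e * (a - b) + e * (a - c) ≡ e * (b - c) + s
    collect = toWitness {a? = all? λ _ → all? λ _ → all? λ _ → all? λ _ → all? λ _ → _ ≟ _} _
    boundary : ∂ φ ≗ λ v → σ zero * dipole y z v + sum (λ i → σ (suc i) * spine-dipole tr i v)
    boundary v = trans (grow-∂ φ₀ jf jg (- σ zero) (σ zero) v)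
      (trans (collect (∂ φ₀ v) (σ zero) (δ x v) (δ y v) (δ z v)) (cong (σ zero * dipole y z v +_) (∂φ₀ v)))
    extends : φ Extends φ₀
    extends {e} φ₀e≢0 with e ∈? T′
    ... | yes e∈T = at-old (off c) (- σ zero) (σ zero) e∈T
    ... | no e∉T  = contradiction (off c e∉T) φ₀e≢0
    connected′ = extend-connected {φ = φ₀} {φ} extends connected
    detour : ∀ a → a ≢ 0F → σ zero ≡ a → Connected (⁅ x ⁆ ∪ S′) φ
    detour 0F a≢0 _ = contradiction refl a≢0
    detour 1F _ σ₀≡1 = add-detour {φ = φ} connected′ y∈S z∈S
      (backward {φ} jf (trans (at-f (off c) _ (σ zero)) (cong (λ a → arc jf (- a) f) σ₀≡1)))
      (forward {φ} jg (trans (at-g (off c) (- σ zero) _) (cong (λ a → arc jg a g) σ₀≡1)))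
    detour 2F _ σ₀≡2 = add-detour {φ = φ} connected′ z∈S y∈S
      (backward {φ} jg (trans (at-g (off c) (- σ zero) _) (cong (λ a → arc jg a g) σ₀≡2)))
      (forward {φ} jf (trans (at-f (off c) _ (σ zero)) (cong (λ a → arc jf (- a) f) σ₀≡2)))

  -- Two disjoint trees

  Disjoint : Subset size → Subset size → Set
  Disjoint U W = ∀ {e} → e ∈ U → e ∉ W

  merge-extendsˡ : ∀ {U W φ ψ} → Disjoint U W → Orients U φ → Orients W ψ → (φ ⊞ ψ) Extends φ
  merge-extendsˡ {U} {φ = φ} disjoint oφ oψ {e} φe≢0 with e ∈? U
  ... | yes e∈U = trans (cong (φ e +_) (off oψ (disjoint e∈U))) (+-identityʳ _)
  ... | no e∉U  = contradiction (off oφ e∉U) φe≢0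

  merge-extendsʳ : ∀ {U W φ ψ} → Disjoint U W → Orients U φ → Orients W ψ → (φ ⊞ ψ) Extends ψ
  merge-extendsʳ {W = W} {ψ = ψ} disjoint oφ oψ {e} ψe≢0 with e ∈? W
  ... | yes e∈W = cong (_+ ψ e) (off oφ (flip disjoint e∈W))
  ... | no e∉W  = contradiction (off oψ e∉W) ψe≢0

  merge : ∀ {U W φ ψ} → Disjoint U W → Orients U φ → Orients W ψ → Orients (U ∪ W) (φ ⊞ ψ)
  merge {U} {W} {φ} {ψ} disjoint oφ oψ = record { off = off′ ; on = on′ }
    where
    off′ : ∀ {e} → e ∉ U ∪ W → φ e + ψ e ≡ 0F
    off′ e∉ = cong₂ _+_ (off oφ (e∉ ∘ x∈p∪q⁺ ∘ inj₁)) (off oψ (e∉ ∘ x∈p∪q⁺ ∘ inj₂))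
    on′ : ∀ {e} → e ∈ U ∪ W → ¬ ⊥ → φ e + ψ e ≢ 0F
    on′ e∈ _ with x∈p∪q⁻ U W e∈
    ... | inj₁ e∈U = let φe≢0 = on oφ e∈U λ () in
      φe≢0 ∘ trans (sym (merge-extendsˡ {φ = φ} {ψ} disjoint oφ oψ φe≢0))
    ... | inj₂ e∈W = let ψe≢0 = on oψ e∈W λ () in
      ψe≢0 ∘ trans (sym (merge-extendsʳ {φ = φ} {ψ} disjoint oφ oψ ψe≢0))

  -- Choosing the signs

  ConnectedSolution : Subset order → Subset size → Charge → Set
  ConnectedSolution S U m = Σ[ ψ ∈ Flow ] Orients U ψ × ∂ ψ ≗ m × Connected S ψ

  HasPoles : Charge → Set
  HasPoles w = ∃₂ λ y z → w y ≡ 1F × w z ≡ 2F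

  module _ {S T k} (tr : Tree S T k) where

    -- With zero residue, `decompose` writes `w` as a combination of triangle indicators alone, and
    -- the poles rule out a single term.
    many-coefficients : ∀ {w} → (∀ v → residue tr w v ≡ 0F) → HasPoles w →
      ∃₂ λ i j → i ≢ j × coeff tr w i ≢ 0F × coeff tr w j ≢ 0F
    many-coefficients {w} residue≡0 (y , z , wy , wz) =
      two-coefficients (coeff tr w) (triangle-at tr) (triangle-at-≢2 tr) (expand wy) (expand wz)
      where
      expand : ∀ {v a} → w v ≡ a → sum (λ j → coeff tr w j * triangle-at tr j v) ≡ a
      expand {v} wv = trans (sym (trans (decompose tr w v)
        (trans (cong (sum (λ j → coeff tr w j * triangle-at tr j v) +_) (residue≡0 v)) (+-identityʳ _)))) wv

    module _ {r} (m : Charge) (w : Fin r → Charge) where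

      Unobstructed : Signs r → Set
      Unobstructed σ = ¬ Obstructed tr (shift m (proj₁ σ) w)

      unobstructed-coeff : ∀ j σ → dot σ (λ i → coeff tr (w i) j) ≡ - coeff tr m j → Unobstructed σ
      unobstructed-coeff j σ eq (coeff≢0 , _) = coeff≢0 j
        (trans (map-shift m (proj₁ σ) w) (trans (cong (coeff tr m j +_) eq) (cancel (coeff tr m j))))
        where
        open Linear (coeff-linear tr j)
        cancel : ∀ a → a - a ≡ 0F
        cancel = toWitness {a? = all? λ _ → _ ≟ _} _

      unobstructed-residue : ∀ v σ → dot σ (λ i → residue tr (w i) v) ≢ - residue tr m v → Unobstructed σ
      unobstructed-residue v σ ≢ (_ , residue≡0) = ≢
        (isolate (residue tr m v) _ (trans (sym (map-shift m (proj₁ σ) w)) (residue≡0 v)))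
        where
        open Linear (residue-linear tr v)
        isolate : ∀ a b → a + b ≡ 0F → b ≡ - a
        isolate = toWitness {a? = all? λ _ → all? λ _ → _ ≟ _ →-dec _ ≟ _} _

      signs-by-residue : ∀ i v → residue tr (w i) v ≢ 0F → ∃[ σ ] Unobstructed σ
      signs-by-residue i v ≢0 =
        let σ , ≢ = signs-avoid (λ i → residue tr (w i) v) i ≢0 (- residue tr m v)
        in σ , unobstructed-residue v σ ≢

      choose-signs : (∀ i → HasPoles (w i)) → k ℕ.< r ℕ.* 2 → ∃[ σ ] Unobstructed σ
      choose-signs poles k<2r with any? (λ i → any? λ v → ¬? (residue tr (w i) v ≟ 0F))
      ... | yes (i , v , ≢0) = signs-by-residue i v ≢0
      ... | no none =
        let i , i′ , a , b , i≢i′ , same = shared-value k<2r index (λ i → proj₁ (proj₂ (proj₂ (found i))))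
            j = index i a
            -- Both `w i` and `w i′` have a nonzero coefficient at triangle `j`, so the signed sum
            -- can be made to cancel the coefficient of `m` there.
            σ , eq = signs-hit (λ i → coeff tr (w i) j) i i′ i≢i′ (index-≢0 i a)
              (subst (λ j → coeff tr (w i′) j ≢ 0F) (sym same) (index-≢0 i′ b)) (- coeff tr m j)
        in σ , unobstructed-coeff j σ eq
        where
        found : ∀ i → ∃₂ λ j j′ → j ≢ j′ × coeff tr (w i) j ≢ 0F × coeff tr (w i) j′ ≢ 0F
        found i = many-coefficients
          (λ v → decidable-stable (residue tr (w i) v ≟ 0F) λ ≢0 → none (i , v , ≢0)) (poles i)
        index : Fin r → Fin 2 → Fin k
        index i 0F = proj₁ (found i)
        index i 1F = proj₁ (proj₂ (found i))
        index-≢0 : ∀ i a → coeff tr (w i) (index i a) ≢ 0F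
        index-≢0 i 0F = proj₁ (proj₂ (proj₂ (proj₂ (found i))))
        index-≢0 i 1F = proj₂ (proj₂ (proj₂ (proj₂ (found i))))

  dipole-poles : ∀ {y z} → y ≢ z → HasPoles (dipole y z)
  dipole-poles {y} {z} y≢z = y , z ,
    cong₂ _-_ (δ-refl y) (δ-≢ (y≢z ∘ sym)) , cong₂ _-_ (δ-≢ y≢z) (δ-refl z)

  opposite-signs : ∀ {r} → Signs r → Signs r
  opposite-signs (σ , σ≢0) = -_ ∘ σ , λ i → -‿≢0 (σ i) (σ≢0 i)

  -- The first tree realises the shifted charge and the second tree, oriented with opposite signs,
  -- takes the shift back.
  shift-cancel : ∀ {r} m σ (w : Fin r → Charge) v → sum (λ i → - σ i * w i v) + shift m σ w v ≡ m v
  shift-cancel m σ w v = begin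
    sum (λ i → - σ i * w i v) + (m v + sum (λ i → σ i * w i v))
      ≡⟨ rotate (sum λ i → - σ i * w i v) (m v) (sum λ i → σ i * w i v) ⟩
    m v + (sum (λ i → - σ i * w i v) + sum (λ i → σ i * w i v))
      ≡⟨ cong (m v +_) (∑-distrib-+ (λ i → - σ i * w i v) (λ i → σ i * w i v)) ⟨
    m v + sum (λ i → - σ i * w i v + σ i * w i v)
      ≡⟨ cong (m v +_) (sum-zero λ i → cancel (σ i) (w i v)) ⟩
    m v + 0F
      ≡⟨ +-identityʳ _ ⟩
    m v ∎
    where
    rotate : ∀ a b c → a + (b + c) ≡ b + (a + c)
    rotate = toWitness {a? = all? λ _ → all? λ _ → all? λ _ → _ ≟ _} _
    cancel : ∀ a b → - a * b + a * b ≡ 0F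
    cancel = toWitness {a? = all? λ _ → all? λ _ → _ ≟ _} _

  module _ {S T₁ T₂ k r} (full : ∀ v → v ∈ S) (disjoint : Disjoint T₁ T₂)
           (tr₁ : Tree S T₁ k) (tr₂ : Tree S T₂ (suc r)) (m : Charge) (balanced-m : sum m ≡ 0F) where

    w₂ = spine-dipole tr₂

    demand-shift : ∀ σ → Demand S (shift m σ w₂)
    demand-shift σ = record
      { support  = λ {v} v∉S → contradiction (full v) v∉S
      ; balanced = begin
          sum (shift m σ w₂)                              ≡⟨ ∑-distrib-+ m (λ v → sum λ i → σ i * w₂ i v) ⟩
          sum m + sum (λ v → sum λ i → σ i * w₂ i v)      ≡⟨ cong₂ _+_ balanced-m (∑-comm λ v i → σ i * w₂ i v) ⟩
          sum (λ i → sum λ v → σ i * w₂ i v)              ≡⟨ sum-zero (λ i →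
                                                               uncurry (sum-dipole (σ i)) (spine tr₂ i)) ⟩
          0F                                             ∎ }

    -- Strong connectivity comes from the second tree alone and survives the merge, so the
    -- orientation of the first tree only has to meet its charge.
    solve-with-signs : ∀ σ → Unobstructed tr₁ m w₂ σ → ConnectedSolution S (T₁ ∪ T₂) m
    solve-with-signs σ free with realize-or-obstructed tr₁ (demand-shift (proj₁ σ))
    ... | inj₂ obstructed = contradiction obstructed free
    ... | inj₁ (φ₁ , o₁ , ∂φ₁) =
      let φ₂ , o₂ , ∂φ₂ , connected = connected-orientation tr₂ (opposite-signs σ)
      in φ₁ ⊞ φ₂ , merge disjoint o₁ o₂
       , (λ v → trans (∂-⊞ φ₁ φ₂ v) (trans (+-comm (∂ φ₁ v) _)
           (trans (cong₂ _+_ (∂φ₂ v) (∂φ₁ v)) (shift-cancel m (proj₁ σ) w₂ v))))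
       , extend-connected {φ = φ₂} {φ₁ ⊞ φ₂} (merge-extendsʳ {φ = φ₁} {φ₂} disjoint o₁ o₂) connected

    solve-large : k ℕ.< r ℕ.* 2 → ConnectedSolution S (T₁ ∪ T₂) m
    solve-large k<2r = uncurry solve-with-signs
      (choose-signs tr₁ m w₂ (λ i → dipole-poles (spine-≢ tr₂ i)) k<2r)

  -- Four vertices

  -- Presents a triangle with base `h` and apex `d`, its unions ordered as `grow` produces them.
  record TriangleOn (S : Subset order) (T : Subset size) (d b c : Vertex) (h : Edge) : Set where
    constructor triangle-on
    field
      {db dc}  : Edge
      joins-db : Joins db d b
      joins-dc : Joins dc d c
      vertices : S ≡ ⁅ d ⁆ ∪ ⁅ b ⁆ ∪ ⁅ c ⁆
      edges    : T ≡ ⁅ db ⁆ ∪ ⁅ dc ⁆ ∪ ⁅ h ⁆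

  -- Any of the three edges may serve as the base; the cases differ in the order of the unions and
  -- the direction of the edge.
  triangle-through : ∀ {S T h b c} → Tree S T 1 → h ∈ T → Joins h b c → ∃[ d ] TriangleOn S T d b c h
  triangle-through (grow {x = x} {y} {z} {_} {f} {g} (base {h = h′} jh′) x∉S h∈ jh jf jg) e∈ je
    with refl ← x∈⁅y⁆⇒x≡y h′ h∈ = from-edge (base-ends (joins-unique jh jh′)) (∈-cons⁻ e∈) je
    where
    base-ends : ∀ {u v} → (u ≡ y × v ≡ z) ⊎ (u ≡ z × v ≡ y) → ⁅ u ⁆ ∪ ⁅ v ⁆ ≡ ⁅ y ⁆ ∪ ⁅ z ⁆
    base-ends (inj₁ (refl , refl)) = refl
    base-ends (inj₂ (refl , refl)) = ∪-comm ⁅ z ⁆ ⁅ y ⁆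
    from-edge : ∀ {U e b c} → U ≡ ⁅ y ⁆ ∪ ⁅ z ⁆ → e ≡ f ⊎ e ∈ ⁅ g ⁆ ∪ ⁅ h′ ⁆ → Joins e b c →
      ∃[ d ] TriangleOn (⁅ x ⁆ ∪ U) (⁅ f ⁆ ∪ ⁅ g ⁆ ∪ ⁅ h′ ⁆) d b c e
    from-edge refl (inj₁ refl) je with joins-unique jf je
    ... | inj₁ (refl , refl) = z , triangle-on (swap jg) (swap jh) (∪-rotate _ _ _) (∪-rotate⁻ _ _ _)
    ... | inj₂ (refl , refl) = z , triangle-on (swap jh) (swap jg) (∪-reverse _ _ _) (∪-reverse _ _ _)
    from-edge refl (inj₂ e∈) je with ∈-cons⁻ e∈
    from-edge refl (inj₂ e∈) je | inj₁ refl with joins-unique jg je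
    ... | inj₁ (refl , refl) = y , triangle-on (swap jf) jh (∪-swap _ _ _) (∪-swapʳ _ _ _)
    ... | inj₂ (refl , refl) = y , triangle-on jh (swap jf) (∪-rotate⁻ _ _ _) (∪-rotate _ _ _)
    from-edge refl (inj₂ e∈) je | inj₂ e∈h with refl ← x∈⁅y⁆⇒x≡y h′ e∈h with joins-unique jh je
    ... | inj₁ (refl , refl) = x , triangle-on jf jg refl refl
    ... | inj₂ (refl , refl) = x , triangle-on jg jf (∪-swapʳ _ _ _) (∪-swap _ _ _)

  -- Two triangles abc and dbc on the common edge bc, with tips `a` and `d`. The parameters list the
  -- spine before the tips, and `a` is the vertex grown last.
  record Diamond (S : Subset order) (T : Subset size) (b c a d : Vertex) : Set where
    constructor diamond
    field
      {bc ab ac db dc} : Edge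
      joins-bc : Joins bc b c
      joins-ab : Joins ab a b
      joins-ac : Joins ac a c
      joins-db : Joins db d b
      joins-dc : Joins dc d c
      fresh-d  : d ∉ ⁅ b ⁆ ∪ ⁅ c ⁆
      fresh-a  : a ∉ ⁅ d ⁆ ∪ ⁅ b ⁆ ∪ ⁅ c ⁆
      vertices : S ≡ ⁅ a ⁆ ∪ ⁅ d ⁆ ∪ ⁅ b ⁆ ∪ ⁅ c ⁆
      edges    : T ≡ ⁅ ab ⁆ ∪ ⁅ ac ⁆ ∪ ⁅ db ⁆ ∪ ⁅ dc ⁆ ∪ ⁅ bc ⁆

    bc∈inner : bc ∈ ⁅ db ⁆ ∪ ⁅ dc ⁆ ∪ ⁅ bc ⁆
    bc∈inner = ∈-old (∈-old (x∈⁅x⁆ bc))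

    inner : Tree (⁅ d ⁆ ∪ ⁅ b ⁆ ∪ ⁅ c ⁆) (⁅ db ⁆ ∪ ⁅ dc ⁆ ∪ ⁅ bc ⁆) 1
    inner = grow (base joins-bc) fresh-d (x∈⁅x⁆ bc) joins-bc joins-db joins-dc

    tree : Tree S T 2
    tree = subst₂ (λ S T → Tree S T 2) (sym vertices) (sym edges)
      (grow inner fresh-a bc∈inner joins-bc joins-ab joins-ac)

    corner : ∀ {v} → v ∈ S → v ≡ a ⊎ v ≡ d ⊎ v ≡ b ⊎ v ≡ c
    corner v∈S with ∈-cons⁻ (subst (_ ∈_) vertices v∈S)
    ... | inj₁ v≡a = inj₁ v≡a
    ... | inj₂ v∈ with ∈-cons⁻ v∈
    ...   | inj₁ v≡d = inj₂ (inj₁ v≡d)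
    ...   | inj₂ v∈ with ∈-cons⁻ v∈
    ...     | inj₁ v≡b = inj₂ (inj₂ (inj₁ v≡b))
    ...     | inj₂ v∈c = inj₂ (inj₂ (inj₂ (x∈⁅y⁆⇒x≡y c v∈c)))

    a≢d : a ≢ d
    a≢d refl = fresh-a ∈-new

  -- The second triangle may be attached to any edge of the first, so the first is rebuilt on that
  -- edge.
  asDiamond : ∀ {S T} → Tree S T 2 → ∃₂ λ b c → ∃₂ λ a d → Diamond S T b c a d
  asDiamond (grow {x = a} {y = b} {c} inner a∉ h∈ jh jf jg)
    with d , triangle-on {db} {dc} jdb jdc refl refl ← triangle-through inner h∈ jh =
    b , c , a , d , diamond jh jf jg jdb jdc d∉ a∉ refl refl
    where
    d∉ : d ∉ ⁅ b ⁆ ∪ ⁅ c ⁆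
    d∉ d∈ = [ joins-≢ jdb , joins-≢ jdc ∘ x∈⁅y⁆⇒x≡y c ]′ (∈-cons⁻ d∈)

  flipDiamond : ∀ {S T b c a d} → Diamond S T b c a d → Diamond S T c b a d
  flipDiamond {b = b} {c} {a} {d} (diamond jbc jab jac jdb jdc d∉ a∉ refl refl) =
    diamond (swap jbc) jac jab jdc jdb
      (d∉ ∘ subst (d ∈_) (∪-comm ⁅ c ⁆ ⁅ b ⁆))
      (a∉ ∘ subst (a ∈_) (∪-swapʳ ⁅ d ⁆ ⁅ c ⁆ ⁅ b ⁆))
      (cong (⁅ a ⁆ ∪_) (∪-swapʳ _ _ _))
      (trans (cong (λ U → _ ∪ _ ∪ U) (∪-swap _ _ _)) (∪-swap _ _ _))

  tree-spine : ∀ {S T b c a d} (D : Diamond S T b c a d) → spine (Diamond.tree D) zero ≡ (b , c)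
  tree-spine (diamond _ _ _ _ _ _ _ refl refl) = refl

  coeff-a : ∀ {S T b c a d} (D : Diamond S T b c a d) w → coeff (Diamond.tree D) w zero ≡ w a
  coeff-a (diamond _ _ _ _ _ _ _ refl refl) w = refl

  -- The tip `d` is not a corner of abc, so dropping that triangle leaves the value at `d`
  -- unchanged.
  coeff-d : ∀ {S T b c a d} (D : Diamond S T b c a d) w → coeff (Diamond.tree D) w (suc zero) ≡ w d
  coeff-d {b = b} {c} {a} {d} (diamond _ _ _ jdb jdc _ a∉ refl refl) w = begin
    w d - w a * (δ a d + δ b d + δ c d)
      ≡⟨ cong (λ t → w d - w a * t) (cong₂ _+_
           (cong₂ _+_ (δ-≢ {u = a} {d} (λ { refl → a∉ ∈-new })) (δ-≢ (joins-≢ jdb ∘ sym))) (δ-≢ (joins-≢ jdc ∘ sym))) ⟩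
    w d - w a * 0F  ≡⟨ vanish (w d) (w a) ⟩
    w d             ∎
    where
    vanish : ∀ p q → p - q * 0F ≡ p
    vanish = toWitness {a? = all? λ _ → all? λ _ → _ ≟ _} _

  module _ {S T b c a d} (D : Diamond S T b c a d) where
    open Diamond D using (bc; ab; ac; db; dc; joins-bc; joins-ab; joins-ac; joins-db; joins-dc)

    record DiamondFlow (bc↦ ab↦ ac↦ db↦ dc↦ : Fin 3) : Set where
      field
        flow    : Flow
        orients : Orients T flow
        at-bc   : flow bc ≡ arc joins-bc bc↦ bc
        at-ab   : flow ab ≡ arc joins-ab ab↦ ab
        at-ac   : flow ac ≡ arc joins-ac ac↦ ac
        at-db   : flow db ≡ arc joins-db db↦ db
        at-dc   : flow dc ≡ arc joins-dc dc↦ dc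
        ∂-flow  : ∀ v → ∂ flow v ≡ bc↦ * dipole b c v + db↦ * dipole d b v + dc↦ * dipole d c v
                                 + ab↦ * dipole a b v + ac↦ * dipole a c v

  diamond-flow : ∀ {S T b c a d} (D : Diamond S T b c a d) p q r s t →
    p ≢ 0F → q ≢ 0F → r ≢ 0F → s ≢ 0F → t ≢ 0F → DiamondFlow D p q r s t
  diamond-flow {b = b} {c} {a} {d} D@(diamond {bc} {ab} {ac} {db} {dc} jbc jab jac jdb jdc d∉ a∉ refl refl)
    p q r s t p≢0 q≢0 r≢0 s≢0 t≢0 = record
      { flow    = φ₁ ⊞ arc jab q ⊞ arc jac r
      ; orients = Outer.carries c₁ (λ _ → q≢0) (λ _ → r≢0)
      ; at-bc   = trans (Outer.at-old (off c₁) q r (Diamond.bc∈inner D)) (Inner.at-old (off c₀) s t (x∈⁅x⁆ bc))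
      ; at-ab   = Outer.at-f (off c₁) q r
      ; at-ac   = Outer.at-g (off c₁) q r
      ; at-db   = trans (Outer.at-old (off c₁) q r ∈-new) (Inner.at-f (off c₀) s t)
      ; at-dc   = trans (Outer.at-old (off c₁) q r (∈-old ∈-new)) (Inner.at-g (off c₀) s t)
      ; ∂-flow  = λ v → trans (grow-∂ φ₁ jab jac q r v)
          (cong (λ x → x + q * dipole a b v + r * dipole a c v) (trans (grow-∂ φ₀ jdb jdc s t v)
          (cong (λ x → x + s * dipole d b v + t * dipole d c v) (∂-arc jbc p v)))) }
    where
    module Inner = Grow (base jbc) d∉ (x∈⁅x⁆ bc) jbc jdb jdc
    module Outer = Grow (Diamond.inner D) a∉ (Diamond.bc∈inner D) jbc jab jac
    φ₀ = arc jbc p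
    c₀ : Orients ⁅ bc ⁆ φ₀
    c₀ = base-carries jbc (λ _ → p≢0)
    φ₁ = φ₀ ⊞ arc jdb s ⊞ arc jdc t
    c₁ : Orients (⁅ db ⁆ ∪ ⁅ dc ⁆ ∪ ⁅ bc ⁆) φ₁
    c₁ = Inner.carries c₀ (λ _ → s≢0) (λ _ → t≢0)

  -- No strongly connected orientation of a single tree extends to one with boundary 0,
  -- so both trees are needed: the arcs ad, db, ba, ac come from T₂ and cb from T₁.
  solve-crossed : ∀ {S T₁ T₂ a b c d} → Disjoint T₁ T₂ →
    Diamond S T₁ b c a d → Diamond S T₂ a d c b → ConnectedSolution S (T₁ ∪ T₂) (λ _ → 0F)
  solve-crossed {a = a} {b} {c} {d} disjoint D₁ D₂ =
    ψ , merge disjoint F₁.orients F₂.orients , boundary , a , to-from ∘ Diamond.corner D₁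
    where
    module D₁ = Diamond D₁
    module D₂ = Diamond D₂
    -- The boundary of `F₁` is 2 at a, c, d and that of `F₂` is 1 there; both are 0 at b, so they
    -- cancel.
    module F₁ = DiamondFlow (diamond-flow D₁ 2F 1F 1F 1F 1F (λ ()) (λ ()) (λ ()) (λ ()) (λ ()))
    module F₂ = DiamondFlow (diamond-flow D₂ 1F 2F 2F 1F 2F (λ ()) (λ ()) (λ ()) (λ ()) (λ ()))
    ψ = F₁.flow ⊞ F₂.flow
    lift₁ : ∀ {u v} → FlowArc F₁.flow u v → FlowArc ψ u v
    lift₁ = extend-arc {F₁.flow} {ψ} (merge-extendsˡ {φ = F₁.flow} {F₂.flow} disjoint F₁.orients F₂.orients)
    lift₂ : ∀ {u v} → FlowArc F₂.flow u v → FlowArc ψ u v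
    lift₂ = extend-arc {F₂.flow} {ψ} (merge-extendsʳ {φ = F₁.flow} {F₂.flow} disjoint F₁.orients F₂.orients)
    a→d = lift₂ (forward {F₂.flow} D₂.joins-bc F₂.at-bc)
    d→b = lift₂ (backward {F₂.flow} D₂.joins-dc F₂.at-dc)
    b→a = lift₂ (forward {F₂.flow} D₂.joins-db F₂.at-db)
    a→c = lift₂ (backward {F₂.flow} D₂.joins-ab F₂.at-ab)
    c→b = lift₁ (backward {F₁.flow} D₁.joins-bc F₁.at-bc)
    to-from : ∀ {v} → v ≡ a ⊎ v ≡ d ⊎ v ≡ b ⊎ v ≡ c → Star (FlowArc ψ) a v × Star (FlowArc ψ) v a
    to-from (inj₁ refl)               = ε , ε
    to-from (inj₂ (inj₁ refl))        = a→d ◅ ε , d→b ◅ b→a ◅ ε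
    to-from (inj₂ (inj₂ (inj₁ refl))) = a→d ◅ d→b ◅ ε , b→a ◅ ε
    to-from (inj₂ (inj₂ (inj₂ refl))) = a→c ◅ ε , c→b ◅ b→a ◅ ε
    cancel : ∀ a b c d →
      2F * (b - c) + 1F * (d - b) + 1F * (d - c) + 1F * (a - b) + 1F * (a - c) +
      (1F * (a - d) + 1F * (b - a) + 2F * (b - d) + 2F * (c - a) + 2F * (c - d)) ≡ 0F
    cancel = toWitness {a? = all? λ _ → all? λ _ → all? λ _ → all? λ _ → _ ≟ _} _
    boundary : ∂ ψ ≗ λ _ → 0F
    boundary v = trans (∂-⊞ F₁.flow F₂.flow v)
      (trans (cong₂ _+_ (F₁.∂-flow v) (F₂.∂-flow v)) (cancel (δ a v) (δ b v) (δ c v) (δ d v)))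

  dipole-support : ∀ {y z v} → dipole y z v ≢ 0F → v ≡ y ⊎ v ≡ z
  dipole-support {y} {z} {v} ≢0 with y ≟ v | z ≟ v
  ... | yes refl | _        = inj₁ refl
  ... | no _     | yes refl = inj₂ refl
  ... | no _     | no _     = contradiction refl ≢0

  -- Two distinct vertices among `p` and `q` are both of them, so only their order may need
  -- flipping.
  align-spine : ∀ {S T p q a d x y} → Diamond S T p q x y → a ≢ d →
    a ≡ p ⊎ a ≡ q → d ≡ p ⊎ d ≡ q → Diamond S T a d x y
  align-spine D a≢d (inj₁ refl) (inj₁ refl) = contradiction refl a≢d
  align-spine D a≢d (inj₁ refl) (inj₂ refl) = D
  align-spine D a≢d (inj₂ refl) (inj₁ refl) = flipDiamond D
  align-spine D a≢d (inj₂ refl) (inj₂ refl) = contradiction refl a≢d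

  -- The tips of the second diamond avoid its spine ad, so they are b and c in some order. Flipping
  -- the first diamond reduces one order to the other.
  solve-aligned : ∀ {S T₁ T₂ a b c d x y} → Disjoint T₁ T₂ →
    Diamond S T₁ b c a d → Diamond S T₂ a d x y → ConnectedSolution S (T₁ ∪ T₂) (λ _ → 0F)
  solve-aligned {S} {a = a} {b} {c} {d} {x} {y} disjoint D₁ D₂ =
    choose (tip (D₁.corner x∈S) (λ { refl → D₂.fresh-a (∈-old ∈-new) })
              (λ { refl → D₂.fresh-a (∈-old (∈-old (x∈⁅x⁆ _))) }))
           (tip (D₁.corner y∈S) (λ { refl → D₂.fresh-d ∈-new })
              (λ { refl → D₂.fresh-d (∈-old (x∈⁅x⁆ _)) }))
    where
    module D₁ = Diamond D₁
    module D₂ = Diamond D₂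
    x∈S : x ∈ S
    x∈S = subst (x ∈_) (sym D₂.vertices) ∈-new
    y∈S : y ∈ S
    y∈S = subst (y ∈_) (sym D₂.vertices) (∈-old ∈-new)
    tip : ∀ {v} → v ≡ a ⊎ v ≡ d ⊎ v ≡ b ⊎ v ≡ c → v ≢ a → v ≢ d → v ≡ b ⊎ v ≡ c
    tip (inj₁ v≡a)        v≢a _   = contradiction v≡a v≢a
    tip (inj₂ (inj₁ v≡d)) _   v≢d = contradiction v≡d v≢d
    tip (inj₂ (inj₂ v≡))  _   _   = v≡
    choose : x ≡ b ⊎ x ≡ c → y ≡ b ⊎ y ≡ c → ConnectedSolution S _ (λ _ → 0F)
    choose (inj₁ refl) (inj₁ refl) = contradiction refl D₂.a≢d
    choose (inj₁ refl) (inj₂ refl) = solve-crossed disjoint (flipDiamond D₁) D₂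
    choose (inj₂ refl) (inj₁ refl) = solve-crossed disjoint D₁ D₂
    choose (inj₂ refl) (inj₂ refl) = contradiction refl D₂.a≢d

  -- Only one dipole `w zero` is available. If its residue vanishes, both its coefficients are
  -- nonzero, so a sign can cancel any nonzero coefficient of `m`, while a nonzero residue of `m` is
  -- unaffected by it. What remains is `m` = 0 with the spine of the second tree joining the tips of
  -- the first.
  solve-small : ∀ {S T₁ T₂ m} → (∀ v → v ∈ S) → Disjoint T₁ T₂ →
    Tree S T₁ 2 → Tree S T₂ 2 → sum m ≡ 0F → ConnectedSolution S (T₁ ∪ T₂) m
  solve-small {S} {T₁} {T₂} {m} full disjoint tr₁ tr₂ balanced-m
    with b , c , a , d , D₁ ← asDiamond tr₁ | p , q , x , y , D₂ ← asDiamond tr₂ = search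
    where
    t₁ = Diamond.tree D₁
    t₂ = Diamond.tree D₂
    w = spine-dipole t₂

    by-signs : ∃[ σ ] Unobstructed t₁ m w σ → ConnectedSolution S (T₁ ∪ T₂) m
    by-signs = uncurry (solve-with-signs full disjoint t₁ t₂ m balanced-m)

    module _ (residue-w : ∀ v → residue t₁ (w zero) v ≡ 0F) where
      coeff-w : ∀ j → coeff t₁ (w zero) j ≢ 0F
      -- Two distinct indices in `Fin 2` exhaust it.
      coeff-w j with many-coefficients t₁ residue-w (dipole-poles (spine-≢ t₂ zero)) | j
      ... | 0F , 0F , i≢j , _ | _ = contradiction refl i≢j
      ... | 0F , 1F , _ , ≢0 , _ | 0F = ≢0
      ... | 0F , 1F , _ , _ , ≢0 | 1F = ≢0
      ... | 1F , 0F , _ , _ , ≢0 | 0F = ≢0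
      ... | 1F , 0F , _ , ≢0 , _ | 1F = ≢0
      ... | 1F , 1F , i≢j , _ | _ = contradiction refl i≢j

      signs-by-coeff : ∀ j → coeff t₁ m j ≢ 0F → ∃[ σ ] Unobstructed t₁ m w σ
      signs-by-coeff j ≢0 =
        let σ , eq = signs-hit₁ (λ i → coeff t₁ (w i) j) (coeff-w j) (- coeff t₁ m j) (-‿≢0 _ ≢0)
        in σ , unobstructed-coeff t₁ m w j σ eq

      signs-by-residue-m : ∀ v → residue t₁ m v ≢ 0F → Unobstructed t₁ m w positive
      signs-by-residue-m v ≢0 = unobstructed-residue t₁ m w v positive
        (λ eq → -‿≢0 _ ≢0 (trans (sym eq) (trans (+-identityʳ _) (residue-w v))))

      -- Both coefficients of the spine dipole of T₂ are its values at the tips of T₁.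
      crossed : ConnectedSolution S (T₁ ∪ T₂) (λ _ → 0F)
      crossed = solve-aligned disjoint D₁ (align-spine D₂ (Diamond.a≢d D₁)
        (on-spine a (coeff-w 0F ∘ trans (coeff-a D₁ (w zero))))
        (on-spine d (coeff-w 1F ∘ trans (coeff-d D₁ (w zero)))))
        where
        on-spine : ∀ v → w zero v ≢ 0F → v ≡ p ⊎ v ≡ q
        on-spine v ≢0 = dipole-support (subst (λ e → uncurry dipole e v ≢ 0F) (tree-spine D₂) ≢0)

    search : ConnectedSolution S (T₁ ∪ T₂) m
    search with any? (λ v → ¬? (residue t₁ (w zero) v ≟ 0F))
    ... | yes (v , ≢0) = by-signs (signs-by-residue t₁ m w zero v ≢0)
    ... | no none with any? (λ j → ¬? (coeff t₁ m j ≟ 0F)) | any? (λ v → ¬? (residue t₁ m v ≟ 0F))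
    ...   | yes (j , ≢0) | _ = by-signs (signs-by-coeff (vanishing none) j ≢0)
    ...   | no _ | yes (v , ≢0) = by-signs (positive , signs-by-residue-m (vanishing none) v ≢0)
    ...   | no no-coeff | no no-residue =
      let ψ , oψ , ∂ψ , connected = crossed (vanishing none)
      in ψ , oψ , (λ v → trans (∂ψ v) (sym (m≡0 v))) , connected
      where
      m≡0 : ∀ v → m v ≡ 0F
      m≡0 v = trans (decompose t₁ m v) (cong₂ _+_
        (sum-zero λ j → cong (_* triangle-at t₁ j v) (vanishing no-coeff j)) (vanishing no-residue v))

  -- From flows to orientations

  ∣vertices∣ : ∀ {S T k} → Tree S T k → ∣ S ∣ ≡ 2 ℕ.+ k
  ∣vertices∣ (base {y} {z} jh) =
    trans (∣cons∣ (joins-≢ jh ∘ x∈⁅y⁆⇒x≡y z)) (cong suc (∣⁅x⁆∣≡1 z))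
  ∣vertices∣ (grow tr x∉S _ _ _ _) = trans (∣cons∣ x∉S) (cong suc (∣vertices∣ tr))

  solve-trees : ∀ {S T₁ T₂ m k l} → (∀ v → v ∈ S) → Disjoint T₁ T₂ → k ≡ l → 2 ℕ.≤ k →
    Tree S T₁ k → Tree S T₂ l → sum m ≡ 0F → ConnectedSolution S (T₁ ∪ T₂) m
  solve-trees {m = m} {suc (suc zero)} full disjoint refl _ tr₁ tr₂ = solve-small full disjoint tr₁ tr₂
  solve-trees {m = m} {suc (suc (suc k))} full disjoint refl _ tr₁ tr₂ balanced-m =
    solve-large full disjoint tr₁ tr₂ m balanced-m
      -- Trees with k + 3 triangles have k + 2 spine dipoles, so the inequality reads 4 + k ≤ 4 + k
      -- * 2.
      (ℕ.s≤s (ℕ.s≤s (ℕ.s≤s (ℕ.s≤s (ℕₚ.m≤m*n k 2)))))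
  solve-trees {k = suc zero} _ _ _ (ℕ.s≤s ())

  -- The value 0 keeps the stored order as a default; boundaries are compared only for nowhere-zero
  -- flows.
  turn : Fin 3 → Vertex × Vertex → Vertex × Vertex
  turn 2F (u , v) = v , u
  turn _  uv      = uv

  turn-joins : ∀ a e → Joins e (proj₁ (turn a (ends e))) (proj₂ (turn a (ends e)))
  turn-joins 0F _ = inj₁ refl
  turn-joins 1F _ = inj₁ refl
  turn-joins 2F _ = inj₂ refl

  toOrientation : Flow → Orientation G
  toOrientation φ = record
    { tail   = λ e → proj₁ (turn (φ e) (ends e))
    ; head   = λ e → proj₂ (turn (φ e) (ends e))
    ; orient = λ e → turn-joins (φ e) e }

  toArc : ∀ {φ u v} → FlowArc φ u v → Orientation.Arc (toOrientation φ) u v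
  toArc (e , inj₁ (p , eq)) =
    let turned = cong₂ turn eq p in e , cong proj₁ turned , cong proj₂ turned
  toArc (e , inj₂ (p , eq)) =
    let turned = cong₂ turn eq p in e , cong proj₁ turned , cong proj₂ turned

  turn-incidence : ∀ a e v → a ≢ 0F →
    δ (proj₁ (turn a (ends e))) v ≡ δ (proj₂ (turn a (ends e))) v + a * incidence e v
  turn-incidence 0F e v a≢0 = contradiction refl a≢0
  turn-incidence 1F e v _ = split (δ (proj₁ (ends e)) v) (δ (proj₂ (ends e)) v)
    where
    split : ∀ a b → a ≡ b + 1F * (a - b)
    split = toWitness {a? = all? λ _ → all? λ _ → _ ≟ _} _
  turn-incidence 2F e v _ = split (δ (proj₁ (ends e)) v) (δ (proj₂ (ends e)) v)
    where
    split : ∀ a b → b ≡ a + 2F * (a - b)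
    split = toWitness {a? = all? λ _ → all? λ _ → _ ≟ _} _

  -- Edge by edge, the indicator of the tail exceeds that of the head by `φ e * incidence e v`.
  residue-outdeg : ∀ φ → (∀ e → φ e ≢ 0F) → ∀ v → let open Orientation (toOrientation φ) in
    mod₃ (outdeg v) ≡ mod₃ (indeg v) + ∂ φ v
  residue-outdeg φ φ≢0 v = begin
    mod₃ (outdeg v)                             ≡⟨ mod₃-count (λ e → does (tail e ≟ v)) ⟩
    sum (λ e → δ (tail e) v)                         ≡⟨ sum-cong-≗ (λ e → turn-incidence (φ e) e v (φ≢0 e)) ⟩
    sum (λ e → δ (head e) v + φ e * incidence e v)   ≡⟨ ∑-distrib-+ (λ e → δ (head e) v) (λ e → φ e * incidence e v) ⟩
    sum (λ e → δ (head e) v) + ∂ φ v                 ≡⟨ cong (_+ ∂ φ v) (mod₃-count (λ e → does (head e ≟ v))) ⟨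
    mod₃ (indeg v) + ∂ φ v                      ∎
    where open Orientation (toOrientation φ)

  -- Directs each edge outside `U` in its stored order, an arbitrary choice whose boundary `inS₃`
  -- charges to `U`.
  remaining : Subset size → Flow
  remaining U e = if does (e ∈? U) then 0F else 1F

  orients-remaining : ∀ U → Orients (∁ U) (remaining U)
  orients-remaining U = record { off = off′ ; on = on′ }
    where
    off′ : ∀ {e} → e ∉ ∁ U → remaining U e ≡ 0F
    off′ {e} e∉ with e ∈? U
    ... | yes _   = refl
    ... | no e∉U = contradiction (x∉p⇒x∈∁p e∉U) e∉
    on′ : ∀ {e} → e ∈ ∁ U → ¬ ⊥ → remaining U e ≢ 0F
    on′ {e} e∈ _ with e ∈? U
    ... | yes e∈U = contradiction e∈U (x∈∁p⇒x∉p e∈)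
    ... | no _    = λ ()

  inS₃ : ∀ U → (∀ m → sum m ≡ 0F → ConnectedSolution ⊤ U m) → InS₃ G
  inS₃ U solve β (dividesℕ q boundary) = realize (solve m balanced-m)
    where
    ρ = remaining U
    m : Charge
    -- Negating `ρ` edge by edge subtracts its boundary, since `ρ` and its negation add up to the
    -- zero flow.
    m v = β v + ∂ (-_ ∘ ρ) v
    balanced-m : sum m ≡ 0F
    balanced-m = begin
      sum m                                                  ≡⟨ ∑-distrib-+ β (∂ (-_ ∘ ρ)) ⟩
      sum β + sum (∂ (-_ ∘ ρ))                               ≡⟨ cong₂ _+_ (sym (sum-cong-≗ (mod₃-toℕ ∘ β))) (sum-∂ (-_ ∘ ρ)) ⟩
      sum (mod₃ ∘ toℕ ∘ β) + 0F                         ≡⟨ cong (_+ 0F) (mod₃-sum (toℕ ∘ β)) ⟨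
      mod₃ (Sum.sum ℕₚ.+-0-commutativeMonoid (toℕ ∘ β)) + 0F ≡⟨ cong (λ n → mod₃ n + 0F) boundary ⟩
      mod₃ (q ℕ.* 3) + 0F                               ≡⟨ cong (_+ 0F) (mod₃-*3 q) ⟩
      0F                                                     ∎
    realize : ConnectedSolution ⊤ U m →
      Σ[ D ∈ Orientation G ] Orientation.StronglyConnected D × Realizes D β
    realize (ψ , oψ , ∂ψ , connected) = toOrientation φ , strong , realizes
      where
      φ = ψ ⊞ ρ
      disjoint : Disjoint U (∁ U)
      disjoint = x∈p⇒x∉∁p
      φ≢0 : ∀ e → φ e ≢ 0F
      φ≢0 e = on (merge disjoint oψ (orients-remaining U)) (subst (e ∈_) (sym (p∪∁p≡⊤ U)) ∈⊤) λ ()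
      strong : ∀ u v → Star (Orientation.Arc (toOrientation φ)) u v
      strong u v with r , to-from ← extend-connected {φ = ψ} {φ}
          (merge-extendsˡ {φ = ψ} {ρ} disjoint oψ (orients-remaining U)) connected =
        Star-map (toArc {φ}) (proj₂ (to-from ∈⊤) ◅◅ proj₁ (to-from ∈⊤))
      ∂φ : ∀ v → ∂ φ v ≡ β v
      ∂φ v = begin
        ∂ φ v                              ≡⟨ ∂-⊞ ψ ρ v ⟩
        ∂ ψ v + ∂ ρ v                      ≡⟨ cong (_+ ∂ ρ v) (∂ψ v) ⟩
        β v + ∂ (-_ ∘ ρ) v + ∂ ρ v         ≡⟨ +-assoc (β v) _ _ ⟩
        β v + (∂ (-_ ∘ ρ) v + ∂ ρ v)       ≡⟨ cong (β v +_) (∂-⊞ (-_ ∘ ρ) ρ v) ⟨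
        β v + ∂ ((-_ ∘ ρ) ⊞ ρ) v           ≡⟨ cong (β v +_) (sum-zero λ e → cong (_* incidence e v) (cancel (ρ e))) ⟩
        β v + 0F                           ≡⟨ +-identityʳ (β v) ⟩
        β v                                ∎
        where
        cancel : ∀ a → - a + a ≡ 0F
        cancel = toWitness {a? = all? λ _ → _ ≟ _} _
      realizes : Realizes (toOrientation φ) β
      realizes v = congruent (outdeg v) (indeg v) (β v)
        (trans (residue-outdeg φ φ≢0 v) (cong (mod₃ (indeg v) +_) (∂φ v)))
        where open Orientation (toOrientation φ)

theorem4p3 : (G : Graph) → Graph.order G ≥ 4 →
    (T₁ T₂ : Subset (Graph.size G)) →
    SpanningTriangleTree G T₁ → SpanningTriangleTree G T₂ →
    EdgeDisjoint T₁ T₂ →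
    InS₃ G
theorem4p3 G order≥4 T₁ T₂ t₁ t₂ disjoint =
  let k₁ , tr₁ = fromTriangleTree t₁
      k₂ , tr₂ = fromTriangleTree t₂
      -- A spanning tree with k triangles has 2 + k = `order` vertices. Hence both trees have
      -- equally many triangles, and at least two.
      size₁ = trans (sym (∣⊤∣≡n order)) (∣vertices∣ tr₁)
      size₂ = trans (sym (∣⊤∣≡n order)) (∣vertices∣ tr₂)
  in inS₃ (T₁ ∪ T₂) λ m → solve-trees (λ _ → ∈⊤) (λ e∈T₁ e∈T₂ → disjoint (_ , x∈p∩q⁺ (e∈T₁ , e∈T₂)))
       (ℕₚ.+-cancelˡ-≡ 2 _ _ (trans (sym size₁) size₂))
       (ℕₚ.+-cancelˡ-≤ 2 _ _ (subst (4 ℕ.≤_) size₁ order≥4)) tr₁ tr₂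
  where
  open Graph G
  open TriangleTrees G
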